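{- Let $n\geq t\geq 1$ be integers. There exists a signed magic square $SMS(n;t)$ if and only if either $n=t=1$, or both $n>2$ and $t>2$.
   Context: For integers $n\ge t\ge 1$, a signed magic square $SMS(n;t)$ is an $n\times n$ array, some of whose cells may be empty, with entries from the set $X$, where $X=\{0,\pm1,\pm2,\ldots,\pm (nt-1)/2\}$ if $nt$ is odd and $X=\{\pm1,\pm2,\ldots,\pm nt/2\}$ if $nt$ is even, such that exactly $t$ cells in every row and exactly $t$ cells in every column are filled, every integer in $X$ appears exactly once in the array, and the sum of (the filled entries of) each row and of each column is zero. -}

module Defs where

open import Data.Fin.Base using (Fin)
open import Data.Integer.Base using (ℤ; 0ℤ; ∣_∣; _+_)
open import Data.List.Base using (List; catMaybes; foldr; length)
open import Data.Maybe.Base using (Maybe; just)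
open import Data.Nat.Base using (ℕ; _*_; _∸_; _/_; _≤_)
open import Data.Nat.Divisibility using (_∣_)
open import Data.Product using (_×_; _,_; ∃!)
open import Data.Sum.Base using (_⊎_)
open import Data.Vec.Functional using (Vector; toList; transpose)
open import Level using (0ℓ)
open import Relation.Binary.PropositionalEquality using (_≡_; _≢_)
open import Relation.Nullary using (¬_)
open import Relation.Unary using (Pred; _∈_)

-- `nothing` is an empty cell; an entry 0 is the filled cell `just 0ℤ`.
PartialArray : ℕ → Set
PartialArray n = Vector (Vector (Maybe ℤ) n) n

X : ℕ → ℕ → Pred ℤ 0ℓ
X n t x = (¬ (2 ∣ n * t) × ∣ x ∣ ≤ (n * t ∸ 1) / 2)
        ⊎ (2 ∣ n * t × x ≢ 0ℤ × ∣ x ∣ ≤ (n * t) / 2)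

row col : ∀ {n} → PartialArray n → Fin n → Vector (Maybe ℤ) n
row A i = A i
col A j = transpose A j

filled : ∀ {n} → Vector (Maybe ℤ) n → List ℤ
filled v = catMaybes (toList v)

sumℤ : List ℤ → ℤ
sumℤ = foldr _+_ 0ℤ

record IsSMS (n t : ℕ) (A : PartialArray n) : Set where
  field
    entries∈X   : ∀ i j {x} → A i j ≡ just x → x ∈ X n t
    row-filled  : ∀ i → length (filled (row A i)) ≡ t
    col-filled  : ∀ j → length (filled (col A j)) ≡ t
    appearsOnce : ∀ x → x ∈ X n t →
                  ∃! _≡_ λ ((i , j) : Fin n × Fin n) → A i j ≡ just x
    row-sum     : ∀ i → sumℤ (filled (row A i)) ≡ 0ℤ
    col-sum     : ∀ j → sumℤ (filled (col A j)) ≡ 0ℤ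

{-# OPTIONS --safe #-}
module Submission where

-- Necessity: for t = 1 < n every row would consist of a zero, and for t = 2 the entry −x would
-- be forced both into the row and into the column of x.
--
-- Sufficiency: fill t broken diagonals of the cyclic n × n grid. A block of four diagonals with
-- rows x, y, −x′, −y′, where x + y does not depend on the row and each −x, −y sits in the column
-- of x, y, has zero row and column sums and can use any 2n consecutive absolute values. So t can
-- be lowered by 4, down to 0, 3, 5 or 6. For t = 3 take a cyclic sequence a and put a i, a i + κ
-- in two cells symmetric about the main diagonal; with the diagonal entry −(a i + a (i − 1) + κ)
-- both the row sums and the column sums vanish. It remains to choose a such that the n numbers
-- a i + a (i − 1) are distinct and fill the gap left by a and a + κ, which zigzag sequences
-- x, y, x+1, y+1, … (consecutive adjacent sums) do, up to local repairs when n is even. For t = 5,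
-- and for t = 6 unless 4 divides n, two such systems are combined.

open import Defs
open import Algebra.Bundles using (CommutativeMonoid)
import Algebra.Properties.AbelianGroup as AbelianGroup
import Algebra.Properties.CommutativeMonoid.Sum as BigSum
open import Data.Bool.Base using (Bool; true; false; if_then_else_)
open import Data.Empty using (⊥-elim)
open import Data.Fin.Base as Fin using (Fin; zero; suc; toℕ; fromℕ; fromℕ<; inject₁; punchOut)
open import Data.Fin.Patterns
open import Data.Fin.Properties as Fin using (any?; _≟_)
open import Data.Integer.Base as ℤ using (ℤ; +_; -[1+_]; 0ℤ; 1ℤ; -1ℤ)
import Data.Integer.Properties as ℤ
import Data.Integer.Tactic.RingSolver as ℤ
open import Data.List.Base as List using (List; length)
open import Data.Maybe.Base using (Maybe; just; nothing; maybe)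
open import Data.Maybe.Properties using (just-injective)
open import Data.Nat.Base as ℕ
  using (ℕ; zero; suc; ⌊_/2⌋; _+_; _*_; _∸_; _/_; _%_; _≤_; _<_; _≥_; _>_; z≤n; s≤s; z<s; s<s)
import Data.Nat.DivMod as ℕ
open import Data.Nat.Divisibility using (_∣_; divides)
import Data.Nat.Properties as ℕ
import Data.Nat.Tactic.RingSolver as ℕ
open import Data.Product using (_×_; _,_; ∃; ∃₂; proj₁; proj₂)
open import Data.Product.Properties using (,-injective)
open import Data.Sum.Base as Sum using (_⊎_; inj₁; inj₂)
open import Data.Vec.Functional as Vector using (Vector; []; _∷_; removeAt)
open import Function.Base using (_∘_; id; case_of_)
open import Function.Bundles using (_⇔_; mk⇔)
open import Function.Definitions using (Injective)
open import Level using (0ℓ)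
open import Relation.Binary.PropositionalEquality
  using (_≡_; _≢_; _≗_; refl; sym; trans; cong; cong₂; subst)
open import Relation.Nullary using (¬_; yes; no; does)
open import Relation.Nullary.Decidable using (dec-true; dec-false; from-yes; _→-dec_)
open import Relation.Unary using (_∈_)

-- Residues 1 and 2 modulo 4 start at 5 and 6 because t = 1 and t = 2 are impossible for n > 2.
--
-- Arithmetic obstacle: for `n` odd the cyclic adjacent sums of a zigzag are `n` consecutive
-- numbers. A plain zigzag misses both extremes and hits the middle twice; this is what the repairs
-- correct.
--
-- Spatial obstacle: for t = n all diagonals are occupied, so a base system must leave its free
-- diagonals where blocks, made of two pairs of adjacent diagonals, can take them. Consecutive
-- diagonals always do. For t = 5 and n = 2m the system also uses diagonals near m, so its blocks
-- are split between two windows. For t = 6 a gap between the diagonals is harmless when 4 divides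
-- n, as t ≡ 2 modulo 4 then leaves two diagonals over, but fatal for t = n ≡ 2 modulo 4, which
-- therefore gets its own construction.

module ℤ-Group = AbelianGroup ℤ.+-0-abelianGroup

private
  variable
    n t : ℕ

-- Necessity: the sizes t = 1 < n and t = 2

some-entry : ∀ {v : Vector (Maybe ℤ) n} {k} → length (filled v) ≡ suc k → ∃₂ λ i x → v i ≡ just x
some-entry {suc n} {v} len with v zero in eq
... | just x = zero , x , eq
... | nothing with i , x , p ← some-entry {v = v ∘ suc} len = suc i , x , p

sole-entry : ∀ {v : Vector (Maybe ℤ) n} → length (filled v) ≡ 1 →
  ∀ {i x} → v i ≡ just x → x ≡ sumℤ (filled v)
sole-entry {suc n} {v} len {zero} p with just x ← v zero | refl ← p with filled (v ∘ suc)
... | List.[] = sym (ℤ.+-identityʳ x)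
sole-entry {suc n} {v} len {suc i} p with v zero
... | just x = ⊥-elim (none (v ∘ suc) (ℕ.suc-injective len) p)
  where
  none : ∀ {n} (v : Vector (Maybe ℤ) n) → length (filled v) ≡ 0 → ∀ {i x} → v i ≢ just x
  none {suc n} v len {zero} p with just _ ← v zero with () ← len
  none {suc n} v len {suc i} p with nothing ← v zero = none (v ∘ suc) len p
... | nothing = sole-entry {v = v ∘ suc} len p

opposite-entry : ∀ {v : Vector (Maybe ℤ) n} → length (filled v) ≡ 2 →
  sumℤ (filled v) ≡ 0ℤ → ∀ {i x} → v i ≡ just x → ∃ λ j → j ≢ i × v j ≡ just (ℤ.- x)
opposite-entry {suc n} {v} len sum≡0 {zero} p with just x ← v zero | refl ← p
  with j , y , q ← some-entry {v = v ∘ suc} (ℕ.suc-injective len)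
  = suc j , (λ ()) , trans q (cong just (trans
      (sole-entry {v = v ∘ suc} (ℕ.suc-injective len) q) (ℤ-Group.inverseʳ-unique x _ sum≡0)))
opposite-entry {suc n} {v} len sum≡0 {suc i} {y} p with v zero in eq
... | just x = zero , (λ ()) , trans eq (cong just (trans (ℤ-Group.inverseˡ-unique x _ sum≡0)
    (cong ℤ.-_ (sym (sole-entry {v = v ∘ suc} (ℕ.suc-injective len) p)))))
... | nothing with j , j≢i , q ← opposite-entry {v = v ∘ suc} len sum≡0 p
  = suc j , (λ { refl → j≢i refl }) , q

same-cell : ∀ {A : PartialArray n} → IsSMS n t A → ∀ {i j i′ j′ x} →
  A i j ≡ just x → A i′ j′ ≡ just x → (i ≡ i′) × (j ≡ j′)
same-cell sms {i} {j} p q with c , _ , unique ← IsSMS.appearsOnce sms _ (IsSMS.entries∈X sms i j p)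
  = ,-injective (trans (sym (unique p)) (unique q))

zero-entry : ∀ {A : PartialArray n} → IsSMS n 1 A → ∀ i → ∃ λ j → A i j ≡ just 0ℤ
zero-entry {A = A} sms i with j , x , p ← some-entry {v = A i} (IsSMS.row-filled sms i)
  = j , trans p (cong just (trans (sole-entry {v = A i} (IsSMS.row-filled sms i) p) (IsSMS.row-sum sms i)))

size-restriction : ∀ {A : PartialArray n} → n ≥ t → t ≥ 1 → IsSMS n t A →
  (n ≡ 1 × t ≡ 1) ⊎ (n > 2 × t > 2)
size-restriction {t = suc (suc (suc t))} n≥t _ _ =
  inj₂ (ℕ.≤-trans (s≤s (s≤s (s≤s z≤n))) n≥t , s≤s (s≤s (s≤s z≤n)))
size-restriction {1} {1} _ _ _ = inj₁ (refl , refl)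
size-restriction {1} {2} (s≤s ()) _ _
size-restriction {suc (suc n)} {1} {A} _ _ sms
  with i≡i′ , _ ← same-cell sms (proj₂ (zero-entry sms zero)) (proj₂ (zero-entry sms (suc zero)))
  with () ← i≡i′
-- x and -x share both a row and a column with x, so -x would occur twice.
size-restriction {suc (suc n)} {2} {A} _ _ sms
  with j , x , p ← some-entry {v = A zero} (IsSMS.row-filled sms zero)
  with j′ , _ , q ← opposite-entry {v = A zero} (IsSMS.row-filled sms zero) (IsSMS.row-sum sms zero) p
     | i′ , i′≢0 , r ← opposite-entry {v = λ i → A i j} (IsSMS.col-filled sms j) (IsSMS.col-sum sms j) p
  = ⊥-elim (i′≢0 (proj₁ (same-cell sms r q)))

-- Folds over a line with known filled cells

-- Sum and number of the entries of a line are one fold: in ℤ with weight `id`, in ℕ with constant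
-- weight 1. Hence the arbitrary monoid and the weight `h`.
module FilledFold (M : CommutativeMonoid 0ℓ 0ℓ) (h : ℤ → CommutativeMonoid.Carrier M) where
  open CommutativeMonoid M renaming (refl to ≈-refl; sym to ≈-sym; trans to ≈-trans)
  open BigSum M using (sum; sum-remove; sum-cong-≋; sum-replicate-zero; ∑-comm)

  weight : Maybe ℤ → Carrier
  weight = maybe h ε

  foldr-filled : (g : Vector (Maybe ℤ) n) →
    List.foldr (λ x s → h x ∙ s) ε (filled g) ≈ sum (weight ∘ g)
  foldr-filled {zero} g = ≈-refl
  foldr-filled {suc n} g with g zero
  ... | just x = ∙-congˡ (foldr-filled (g ∘ suc))
  ... | nothing = ≈-trans (foldr-filled (g ∘ suc)) (≈-sym (identityˡ _))

  sum-ε : (f : Vector Carrier n) → (∀ i → f i ≈ ε) → sum f ≈ ε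
  sum-ε {n} f f≈ε = ≈-trans (sum-cong-≋ f≈ε) (sum-replicate-zero n)

  sum-single : (p : Fin n) (f : Vector Carrier n) → (∀ i → i ≢ p → f i ≈ ε) → sum f ≈ f p
  sum-single {suc n} p f elsewhere = ≈-trans (sum-remove f)
    (≈-trans (∙-congˡ (sum-ε (removeAt f p) λ i → elsewhere _ (Fin.punchInᵢ≢i p i))) (identityʳ _))

  module _ (g : Vector (Maybe ℤ) n) (p : Fin t → Fin n) (p-inj : Injective _≡_ _≡_ p)
    (v : Vector ℤ t) (hit : ∀ d → g (p d) ≡ just (v d))
    (empty : ∀ j → (∀ d → p d ≢ j) → g j ≡ nothing) where

    private
      cell : Fin n → Fin t → Carrier
      cell j d = if does (p d ≟ j) then h (v d) else ε

      cell-≡ : ∀ {j d} → p d ≡ j → cell j d ≡ h (v d)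
      cell-≡ eq rewrite dec-true (p _ ≟ _) eq = refl

      cell-≢ : ∀ {j d} → p d ≢ j → cell j d ≡ ε
      cell-≢ neq rewrite dec-false (p _ ≟ _) neq = refl

      weight-cells : ∀ j → weight (g j) ≈ sum (cell j)
      weight-cells j with any? (λ d → p d ≟ j)
      ... | yes (d , refl) = ≈-sym (≈-trans
              (sum-single d (cell (p d)) λ e e≢d → reflexive (cell-≢ (e≢d ∘ p-inj)))
              (reflexive (trans (cell-≡ refl) (sym (cong weight (hit d))))))
      ... | no missed = ≈-trans
              (reflexive (cong weight (empty j λ d eq → missed (d , eq))))
              (≈-sym (sum-ε (cell j) λ d → reflexive (cell-≢ λ eq → missed (d , eq))))

    -- Double counting: the weight of position j is the sum over d of `cell j d`, which is neutral
    -- unless the d-th filled position is j. After exchanging the two sums, each d contributes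
    -- exactly once.
    fold-cells : List.foldr (λ x s → h x ∙ s) ε (filled g) ≈ sum (h ∘ v)
    fold-cells = ≈-trans (foldr-filled g) (≈-trans (sum-cong-≋ weight-cells)
      (≈-trans (∑-comm cell) (sum-cong-≋ λ d → ≈-trans
        (sum-single (p d) (λ j → cell j d) λ j j≢pd → reflexive (cell-≢ (j≢pd ∘ sym)))
        (reflexive (cell-≡ refl)))))

open BigSum ℤ.+-0-commutativeMonoid using (sum) public

sumℤ-cells : ∀ (g : Vector (Maybe ℤ) n) (p : Fin t → Fin n) → Injective _≡_ _≡_ p →
  (v : Vector ℤ t) → (∀ d → g (p d) ≡ just (v d)) →
  (∀ j → (∀ d → p d ≢ j) → g j ≡ nothing) → sumℤ (filled g) ≡ sum v
sumℤ-cells = FilledFold.fold-cells ℤ.+-0-commutativeMonoid id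

length-cells : ∀ (g : Vector (Maybe ℤ) n) (p : Fin t → Fin n) → Injective _≡_ _≡_ p →
  (v : Vector ℤ t) → (∀ d → g (p d) ≡ just (v d)) →
  (∀ j → (∀ d → p d ≢ j) → g j ≡ nothing) → List.length (filled g) ≡ t
length-cells {t = t} g p p-inj v hit empty =
  trans (foldr-length (filled g))
    (trans (FilledFold.fold-cells ℕ.+-0-commutativeMonoid (λ _ → 1) g p p-inj v hit empty)
      (sum-ones t))
  where
  foldr-length : (xs : List ℤ) → List.length xs ≡ List.foldr (λ _ s → 1 + s) 0 xs
  foldr-length List.[] = refl
  foldr-length (_ List.∷ xs) = cong suc (foldr-length xs)
  sum-ones : ∀ t → BigSum.sum ℕ.+-0-commutativeMonoid {t} (λ _ → 1) ≡ t
  sum-ones zero = refl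
  sum-ones (suc t) = cong suc (sum-ones t)

-- Pigeonhole: if j were missed, punching it out of the codomain would inject `Fin (suc n)` into
-- `Fin n`.
injective⇒surjective : (f : Fin n → Fin n) → Injective _≡_ _≡_ f → ∀ j → ∃ λ i → f i ≡ j
injective⇒surjective {suc n} f f-inj j with any? (λ i → f i ≟ j)
... | yes found = found
... | no missed = ⊥-elim (Fin.<⇒notInjective {f = λ i → punchOut (j≢f i)} ℕ.≤-refl
        λ eq → f-inj (Fin.punchOut-injective (j≢f _) (j≢f _) eq))
  where
  j≢f : ∀ i → j ≢ f i
  j≢f i eq = missed (i , sym eq)

-- Cyclic shifts

-- The cyclic predecessor i - 1 modulo `n`; its iterate `shift k` is i - k modulo `n`.
σ : Fin n → Fin n
σ {suc n} zero = fromℕ n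
σ (suc i) = inject₁ i

shift : ℕ → Fin n → Fin n
shift zero i = i
shift (suc k) i = shift k (σ i)

toℕ-shift-≥ : ∀ k (i : Fin n) {j} → toℕ i ≡ k + j → toℕ (shift k i) ≡ j
toℕ-shift-≥ zero i eq = eq
toℕ-shift-≥ (suc k) (suc i) eq =
  toℕ-shift-≥ k (inject₁ i) (trans (Fin.toℕ-inject₁ i) (ℕ.suc-injective eq))

toℕ-shift-< : ∀ k (i : Fin n) {j} → toℕ i < k → toℕ i + n ≡ k + j → toℕ (shift k i) ≡ j
toℕ-shift-< {suc n} (suc k) zero _ eq =
  toℕ-shift-≥ k (fromℕ n) (trans (Fin.toℕ-fromℕ n) (ℕ.suc-injective eq))
toℕ-shift-< {suc n} (suc k) (suc i) (s≤s i<k) eq =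
  toℕ-shift-< k (inject₁ i) (subst (_< k) (sym (Fin.toℕ-inject₁ i)) i<k)
    (trans (cong (_+ suc n) (Fin.toℕ-inject₁ i)) (ℕ.suc-injective eq))

shift-injective : ∀ k → Injective _≡_ _≡_ (shift {n} k)
shift-injective {n} k {i} {j} eq = Fin.toℕ-injective (helper k i j eq)
  where
  σ-injective : ∀ {n} {i j : Fin n} → σ i ≡ σ j → i ≡ j
  σ-injective {i = zero} {zero} _ = refl
  σ-injective {i = zero} {suc j} eq = ⊥-elim (Fin.fromℕ≢inject₁ eq)
  σ-injective {i = suc i} {zero} eq = ⊥-elim (Fin.fromℕ≢inject₁ (sym eq))
  σ-injective {i = suc i} {suc j} eq = cong suc (Fin.inject₁-injective eq)
  helper : ∀ k (i j : Fin n) → shift k i ≡ shift k j → toℕ i ≡ toℕ j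
  helper zero i j eq = cong toℕ eq
  helper (suc k) i j eq = cong toℕ (σ-injective (Fin.toℕ-injective (helper k (σ i) (σ j) eq)))

unshift : ∀ k (i : Fin n) → ∃ λ j → shift k j ≡ i
unshift k = injective⇒surjective (shift k) (shift-injective k)

shift-offset : ∀ k (i : Fin n) → k < n →
  (toℕ (shift k i) + k ≡ toℕ i) ⊎ (toℕ (shift k i) + k ≡ toℕ i + n)
shift-offset {n} k i k<n with ℕ.<-≤-connex (toℕ i) k
... | inj₂ k≤i = inj₁ (trans (cong (_+ k) (toℕ-shift-≥ k i (sym (ℕ.m+[n∸m]≡n k≤i)))) (ℕ.m∸n+n≡m k≤i))
... | inj₁ i<k = inj₂ (trans (cong (_+ k) (toℕ-shift-< k i i<k (sym (ℕ.m+[n∸m]≡n k≤)))) (ℕ.m∸n+n≡m k≤))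
  where
  k≤ : k ≤ toℕ i + n
  k≤ = ℕ.≤-trans (ℕ.<⇒≤ k<n) (ℕ.m≤n+m n (toℕ i))

beyond : ∀ a {k l} → l < n → a + l ≢ a + k + n
beyond {n} a {k} {l} l<n eq = ℕ.<-irrefl (ℕ.+-cancelˡ-≡ a l (k + n) (trans eq (ℕ.+-assoc a k n)))
  (ℕ.<-≤-trans l<n (ℕ.m≤n+m n k))

-- Each shift wraps around at most once. If both or neither wrap, cancellation gives the claim; if
-- just one does, k and l differ by exactly `n`, although both are below `n`.
shift-distinct : ∀ {k l} (i : Fin n) → k < n → l < n → shift k i ≡ shift l i → k ≡ l
shift-distinct {n} {k} {l} i k<n l<n eq with shift-offset k i k<n | shift-offset l i l<n
... | inj₁ p | inj₁ q = ℕ.+-cancelˡ-≡ _ k l (trans p (trans (sym q) (cong ((_+ l) ∘ toℕ) (sym eq))))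
... | inj₂ p | inj₂ q = ℕ.+-cancelˡ-≡ _ k l (trans p (trans (sym q) (cong ((_+ l) ∘ toℕ) (sym eq))))
... | inj₁ p | inj₂ q = ⊥-elim (beyond (toℕ (shift k i)) l<n
        (trans (cong (λ z → toℕ z + l) eq) (trans q (cong (_+ n) (sym p)))))
... | inj₂ p | inj₁ q = ⊥-elim (beyond (toℕ (shift l i)) k<n
        (trans (cong (λ z → toℕ z + k) (sym eq)) (trans p (cong (_+ n) (sym q)))))


-- From circulant systems to signed magic squares

Occurs : (Fin n → Vector ℤ t) → ℤ → Set
Occurs val x = ∃₂ λ i d → val i d ≡ x

-- The filled cells of column j lie in the rows j − off d (mod n), and val i d is the entry of
-- row i on the d-th of these broken diagonals. The entries are 0 (ε times) and ±1, …, ±N;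
-- by counting it is enough that each of them occurs.
record Circulant (n t ε N : ℕ) (off : Vector ℕ t) : Set where
  field
    val      : Fin n → Vector ℤ t
    size     : n * t ≡ ε + (N + N)
    row-zero : ∀ i → sum (val i) ≡ 0ℤ
    col-zero : ∀ j → sum (λ d → val (shift (off d) j) d) ≡ 0ℤ
    occurs⁰  : Fin ε → Occurs val 0ℤ
    occurs⁺  : ∀ {y} → y < N → Occurs val (+ suc y)
    occurs⁻  : ∀ {y} → y < N → Occurs val -[1+ y ]

-- The two cases in the definition of `X`: `ε`, the number of zeros, is the parity of the number k
-- of filled cells, and `N` is the largest absolute value.
Parity : ℕ → ℕ → ℕ → Set
Parity k ε N = (ε ≡ 0 × 2 ∣ k × k / 2 ≡ N) ⊎ (ε ≡ 1 × ¬ (2 ∣ k) × (k ∸ 1) / 2 ≡ N)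

halves : ∀ {k ε N} → k ≡ ε + (N + N) → ε ≤ 1 → Parity k ε N
halves {ε = ε} {N} refl ε≤1 = go ε≤1
  where
  N+N≡N*2 : N + N ≡ N * 2
  N+N≡N*2 = trans (cong (_+_ N) (sym (ℕ.+-identityʳ N))) (ℕ.*-comm 2 N)

  N+N/2≡N : (N + N) / 2 ≡ N
  N+N/2≡N = trans (cong (_/ 2) N+N≡N*2) (ℕ.m*n/n≡m N 2)

  odd : ¬ (2 ∣ suc (N + N))
  odd (divides q eq) = ℕ.even≢odd q N (trans (ℕ.*-comm 2 q) (trans (sym eq)
    (cong (λ z → suc (N + z)) (sym (ℕ.+-identityʳ N)))))

  go : ∀ {ε} → ε ≤ 1 → Parity (ε + (N + N)) ε N
  go z≤n = inj₁ (refl , divides N N+N≡N*2 , N+N/2≡N)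
  go (s≤s z≤n) = inj₂ (refl , odd , N+N/2≡N)

module ToSMS {n t ε N : ℕ} {off : Vector ℕ t} (C : Circulant n t ε N off) (ε≤1 : ε ≤ 1)
  (off< : ∀ d → off d < n) (off-inj : Injective _≡_ _≡_ off) where
  open Circulant C

  entry : Fin ε ⊎ (Fin N ⊎ Fin N) → ℤ
  entry (inj₁ _) = 0ℤ
  entry (inj₂ (inj₁ y)) = + suc (toℕ y)
  entry (inj₂ (inj₂ y)) = -[1+ toℕ y ]

  entry-injective : Injective _≡_ _≡_ entry
  entry-injective {inj₁ a} {inj₁ b} _ = cong inj₁ (Fin.toℕ-injective
    (trans (ℕ.n<1⇒n≡0 (bound a)) (sym (ℕ.n<1⇒n≡0 (bound b)))))
    where
    bound : ∀ (a : Fin ε) → toℕ a < 1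
    bound a = ℕ.<-≤-trans (Fin.toℕ<n a) ε≤1
  entry-injective {inj₂ (inj₁ a)} {inj₂ (inj₁ b)} eq =
    cong (inj₂ ∘ inj₁) (Fin.toℕ-injective (ℕ.suc-injective (ℤ.+-injective eq)))
  entry-injective {inj₂ (inj₂ a)} {inj₂ (inj₂ b)} eq =
    cong (inj₂ ∘ inj₂) (Fin.toℕ-injective (ℤ.-[1+-injective eq))
  entry-injective {inj₁ _} {inj₂ (inj₁ _)} ()
  entry-injective {inj₁ _} {inj₂ (inj₂ _)} ()
  entry-injective {inj₂ (inj₁ _)} {inj₁ _} ()
  entry-injective {inj₂ (inj₂ _)} {inj₁ _} ()
  entry-injective {inj₂ (inj₁ _)} {inj₂ (inj₂ _)} ()
  entry-injective {inj₂ (inj₂ _)} {inj₂ (inj₁ _)} ()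

  split : Fin (ε + (N + N)) → Fin ε ⊎ (Fin N ⊎ Fin N)
  split k = Sum.map₂ (Fin.splitAt N) (Fin.splitAt ε k)

  unsplit : Fin ε ⊎ (Fin N ⊎ Fin N) → Fin (ε + (N + N))
  unsplit c = Fin.join ε (N + N) (Sum.map₂ (Fin.join N N) c)

  unsplit-split : ∀ k → unsplit (split k) ≡ k
  unsplit-split k with Fin.splitAt ε k in eq
  ... | inj₁ a = trans (cong (Fin.join ε (N + N)) (sym eq)) (Fin.join-splitAt ε (N + N) k)
  ... | inj₂ b = trans (cong (Fin.join ε (N + N)) (trans (cong inj₂ (Fin.join-splitAt N N b)) (sym eq)))
                   (Fin.join-splitAt ε (N + N) k)

  split-injective : Injective _≡_ _≡_ split
  split-injective {k} {l} eq =
    trans (sym (unsplit-split k)) (trans (cong unsplit eq) (unsplit-split l))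

  locate : ∀ c → Occurs val (entry c)
  locate (inj₁ a) = occurs⁰ a
  locate (inj₂ (inj₁ y)) = occurs⁺ (Fin.toℕ<n y)
  locate (inj₂ (inj₂ y)) = occurs⁻ (Fin.toℕ<n y)

  -- Chooses, for every required value, a cell that carries it. By `size` there are as many values
  -- as cells, so this is a self-map of `Fin (n * t)`.
  cell : Fin (n * t) → Fin (n * t)
  cell k = Fin.combine (proj₁ l) (proj₁ (proj₂ l))
    where l = locate (split (subst Fin size k))

  value : Fin (n * t) → ℤ
  value k = val (proj₁ (Fin.remQuot t k)) (proj₂ (Fin.remQuot {n} t k))

  value-combine : ∀ i d → value (Fin.combine i d) ≡ val i d
  value-combine i d = cong (λ (i , d) → val i d) (Fin.remQuot-combine i d)

  value-cell : ∀ k → value (cell k) ≡ entry (split (subst Fin size k))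
  value-cell k = trans (value-combine _ _) (proj₂ (proj₂ (locate (split (subst Fin size k)))))

  subst-injective : ∀ {a b} (p : a ≡ b) {k l : Fin a} → subst Fin p k ≡ subst Fin p l → k ≡ l
  subst-injective refl eq = eq

  value-cell-injective : Injective _≡_ _≡_ (value ∘ cell)
  value-cell-injective {k} {l} eq = subst-injective size (split-injective (entry-injective
    (trans (sym (value-cell k)) (trans eq (value-cell l)))))

  cell-injective : Injective _≡_ _≡_ cell
  cell-injective eq = value-cell-injective (cong value eq)

  -- The counting argument: distinct values sit in distinct cells, so `cell` is injective and hence
  -- surjective. Every cell is thus the chosen cell of some value, and cells with equal values
  -- coincide.
  value-injective : Injective _≡_ _≡_ value
  value-injective {k} {l} eq
    with k′ , refl ← injective⇒surjective cell cell-injective k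
       | l′ , refl ← injective⇒surjective cell cell-injective l
    = cong cell (value-cell-injective {k′} {l′} eq)

  -- Surjectivity of `cell` once more: no cell is left over for a value outside the list.
  val-entry : ∀ i d → ∃ λ c → val i d ≡ entry c
  val-entry i d with k , eq ← injective⇒surjective cell cell-injective (Fin.combine i d)
    = _ , trans (sym (value-combine i d)) (trans (cong value (sym eq)) (value-cell k))

  val-injective : ∀ {i i′ d d′} → val i d ≡ val i′ d′ → i ≡ i′ × d ≡ d′
  val-injective {i} {i′} {d} {d′} eq = Fin.combine-injective i d i′ d′ (value-injective
    (trans (value-combine i d) (trans eq (sym (value-combine i′ d′)))))

  parity : Parity (n * t) ε N
  parity = halves size ε≤1

  entry∈X : ∀ c → entry c ∈ X n t
  entry∈X c with parity
  entry∈X (inj₁ a) | inj₁ (refl , _) = ⊥-elim (Fin.¬Fin0 a)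
  entry∈X (inj₂ (inj₁ y)) | inj₁ (_ , even , refl) = inj₂ (even , (λ ()) , Fin.toℕ<n y)
  entry∈X (inj₂ (inj₂ y)) | inj₁ (_ , even , refl) = inj₂ (even , (λ ()) , Fin.toℕ<n y)
  entry∈X (inj₁ _) | inj₂ (_ , odd , _) = inj₁ (odd , z≤n)
  entry∈X (inj₂ (inj₁ y)) | inj₂ (_ , odd , refl) = inj₁ (odd , Fin.toℕ<n y)
  entry∈X (inj₂ (inj₂ y)) | inj₂ (_ , odd , refl) = inj₁ (odd , Fin.toℕ<n y)

  X⊆entry : ∀ x → x ∈ X n t → Occurs val x
  X⊆entry x x∈X with parity | x∈X
  X⊆entry x _ | inj₁ (_ , even , _) | inj₁ (odd , _) = ⊥-elim (odd even)
  X⊆entry x _ | inj₂ (_ , odd , _) | inj₂ (even , _) = ⊥-elim (odd even)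
  X⊆entry (+ zero) _ | inj₁ _ | inj₂ (_ , x≢0 , _) = ⊥-elim (x≢0 refl)
  X⊆entry (+ suc y) _ | inj₁ (_ , _ , refl) | inj₂ (_ , _ , y<N) = occurs⁺ y<N
  X⊆entry -[1+ y ] _ | inj₁ (_ , _ , refl) | inj₂ (_ , _ , y<N) = occurs⁻ y<N
  X⊆entry (+ zero) _ | inj₂ (refl , _) | inj₁ _ = occurs⁰ zero
  X⊆entry (+ suc y) _ | inj₂ (_ , _ , refl) | inj₁ (_ , y<N) = occurs⁺ y<N
  X⊆entry -[1+ y ] _ | inj₂ (_ , _ , refl) | inj₁ (_ , y<N) = occurs⁻ y<N

  row-of : Fin n → Fin t → Fin n
  row-of j d = shift (off d) j

  col-of : Fin n → Fin t → Fin n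
  col-of i d = proj₁ (unshift (off d) i)

  row-of-col-of : ∀ i d → row-of (col-of i d) d ≡ i
  row-of-col-of i d = proj₂ (unshift (off d) i)

  col-of-row-of : ∀ j d → col-of (row-of j d) d ≡ j
  col-of-row-of j d = shift-injective (off d) (row-of-col-of (row-of j d) d)

  row-of-injective : ∀ j → Injective _≡_ _≡_ (row-of j)
  row-of-injective j {d} {e} eq = off-inj (shift-distinct j (off< d) (off< e) eq)

  col-of-injective : ∀ i → Injective _≡_ _≡_ (col-of i)
  col-of-injective i {d} {e} eq = row-of-injective (col-of i d)
    (trans (row-of-col-of i d) (trans (sym (row-of-col-of i e)) (cong (λ j → row-of j e) (sym eq))))

  A : PartialArray n
  A i j with any? (λ d → row-of j d ≟ i)
  ... | yes (d , _) = just (val i d)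
  ... | no _ = nothing

  A-hit : ∀ j d → A (row-of j d) j ≡ just (val (row-of j d) d)
  A-hit j d with any? (λ e → row-of j e ≟ row-of j d)
  ... | yes (e , eq) = cong (just ∘ val (row-of j d)) (row-of-injective j eq)
  ... | no missed = ⊥-elim (missed (d , refl))

  A-empty : ∀ i j → (∀ d → row-of j d ≢ i) → A i j ≡ nothing
  A-empty i j missed with any? (λ d → row-of j d ≟ i)
  ... | yes (d , eq) = ⊥-elim (missed d eq)
  ... | no _ = refl

  A-just : ∀ i j {x} → A i j ≡ just x → ∃ λ d → row-of j d ≡ i × val i d ≡ x
  A-just i j eq with any? (λ d → row-of j d ≟ i)
  ... | yes (d , p) = d , p , just-injective eq
  A-just i j () | no _

  A-hit′ : ∀ i d → A i (col-of i d) ≡ just (val i d)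
  A-hit′ i d = subst (λ k → A k (col-of i d) ≡ just (val k d)) (row-of-col-of i d) (A-hit (col-of i d) d)

  A-empty′ : ∀ i j → (∀ d → col-of i d ≢ j) → A i j ≡ nothing
  A-empty′ i j missed = A-empty i j λ where
    d refl → missed d (col-of-row-of j d)

  A-unique : ∀ {i d ij} → A (proj₁ ij) (proj₂ ij) ≡ just (val i d) → (i , col-of i d) ≡ ij
  A-unique {i} {d} {i′ , j′} eq
    with d′ , p , q ← A-just i′ j′ eq
    with refl , refl ← val-injective q
    = cong (i ,_) (trans (cong (λ k → col-of k d) (sym p)) (col-of-row-of j′ d))

  isSMS : IsSMS n t A
  isSMS = record
    { entries∈X = λ i j eq → case A-just i j eq of λ where
        (d , _ , refl) → case val-entry i d of λ where
          (c , p) → subst (_∈ X n t) (sym p) (entry∈X c)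
    ; row-filled = λ i → length-cells (A i) (col-of i) (col-of-injective i) (val i) (A-hit′ i) (A-empty′ i)
    ; col-filled = λ j →
        length-cells (λ i → A i j) (row-of j) (row-of-injective j) _ (A-hit j) (λ i → A-empty i j)
    ; appearsOnce = λ x x∈X → case X⊆entry x x∈X of λ where
        (i , d , refl) → (i , col-of i d) , A-hit′ i d , λ {ij} eq → A-unique {ij = ij} eq
    ; row-sum = λ i → trans
        (sumℤ-cells (A i) (col-of i) (col-of-injective i) (val i) (A-hit′ i) (A-empty′ i)) (row-zero i)
    ; col-sum = λ j → trans
        (sumℤ-cells (λ i → A i j) (row-of j) (row-of-injective j) _ (A-hit j) (λ i → A-empty i j))
        (col-zero j)
    }

-- Splitting intervals, and the extension by four diagonals

private
  variable
    ε N : ℕ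
    off : Vector ℕ t

-- Solves goals linear in a hypothesis a ≡ b; the second argument is then a ring identity.
ℤ-balance : ∀ {a b l r : ℤ} → a ≡ b → l ℤ.+ b ≡ r ℤ.+ a → l ≡ r
ℤ-balance {a} refl eq = ℤ-Group.∙-cancelʳ a _ _ eq

split-< : ∀ a {b y} → y < a + b → y < a ⊎ ∃ λ z → z < b × y ≡ a + z
split-< zero y<b = inj₂ (_ , y<b , refl)
split-< (suc a) {y = zero} _ = inj₁ z<s
split-< (suc a) {y = suc y} (s≤s y<a+b) =
  Sum.map s<s (λ (z , z<b , eq) → z , z<b , cong suc eq) (split-< a y<a+b)

halve : ∀ n {y} → y < n + n → ∃ λ i → i < n × (y ≡ i + i ⊎ y ≡ suc (i + i))
halve (suc n) {zero} _ = 0 , z<s , inj₁ refl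
halve (suc n) {suc zero} _ = 0 , z<s , inj₂ refl
halve (suc n) {suc (suc y)} (s≤s y<)
  with i , i<n , eq ← halve n (ℕ.s≤s⁻¹ (subst (suc y <_) (ℕ.+-suc n n) y<))
  = suc i , s<s i<n , Sum.map step step eq
  where
  step : ∀ {a} → y ≡ a + i → suc (suc y) ≡ suc (a + suc i)
  step {a} refl = cong suc (sym (ℕ.+-suc a i))

shift-+ : ∀ k l (i : Fin n) → shift (k + l) i ≡ shift l (shift k i)
shift-+ zero l i = refl
shift-+ (suc k) l i = shift-+ k l (σ i)

sum-cong : {f g : Vector ℤ t} → f ≗ g → sum f ≡ sum g
sum-cong {zero} eq = refl
sum-cong {suc t} eq = cong₂ ℤ._+_ (eq zero) (sum-cong (eq ∘ suc))

empty : Circulant n 0 0 0 []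
empty {n} = record
  { val = λ _ → []
  ; size = ℕ.*-zeroʳ n
  ; row-zero = λ _ → refl
  ; col-zero = λ _ → refl
  ; occurs⁰ = λ ()
  ; occurs⁺ = λ ()
  ; occurs⁻ = λ ()
  }

-- The new diagonals are 0, 1, s and s + 1; the old ones move up by w.
block : ℕ → ℕ → Vector ℕ t → Vector ℕ (4 + t)
block s w off = 0 ∷ 1 ∷ s ∷ suc s ∷ Vector.map (_+_ w) off

-- x i = N + 1 + 2i and y i = -(N + 2 + 2i) share the next 2n absolute values alternately, and x i +
-- y i = -1 in every row. Lifting the old diagonals by w only relabels their columns cyclically. The
-- distance s between the pairs and the lift w are parameters because blocks are later stacked in
-- two ways.
extend : ∀ s w → Circulant n t ε N off → Circulant n (4 + t) ε (N + (n + n)) (block s w off)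
extend {n} {t} {ε} {N} {off} s w C = record
  { val = val′
  ; size = trans (expand n t) (trans (cong (λ z → z + (n + n + (n + n))) size) (regroup ε N n))
  ; row-zero = λ i → trans (row-+ (x i) (y i) (x (shift s i)) (y (shift s i)) _)
      (cong₂ ℤ._+_ (cong₂ (λ a b → a ℤ.+ ℤ.- b) (x+y i) (x+y (shift s i))) (row-zero i))
  ; col-zero = λ j → trans (col-+ (x (shift s j)) (y (shift s (σ j))) _)
      (trans (sum-cong λ d → cong (λ k → val k d) (shift-+ w (off d) j)) (col-zero (shift w j)))
  ; occurs⁰ = λ z → old (occurs⁰ z)
  ; occurs⁺ = λ y< → plus (split-< N y<)
  ; occurs⁻ = λ y< → minus (split-< N y<)
  }
  where
  open Circulant C
  x y : Fin n → ℤ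
  x i = + suc (N + (toℕ i + toℕ i))
  y i = -[1+ suc (N + (toℕ i + toℕ i)) ]

  val′ : Fin n → Vector ℤ (4 + t)
  val′ i = ℤ.- x (shift s i) ∷ ℤ.- y (shift s i) ∷ x i ∷ y i ∷ val i

  expand : ∀ n t → n * (4 + t) ≡ n * t + (n + n + (n + n))
  expand = ℕ.solve-∀
  regroup : ∀ ε N n → ε + (N + N) + (n + n + (n + n)) ≡ ε + (N + (n + n) + (N + (n + n)))
  regroup = ℕ.solve-∀
  row-+ : ∀ x y x′ y′ r → ℤ.- x′ ℤ.+ (ℤ.- y′ ℤ.+ (x ℤ.+ (y ℤ.+ r))) ≡ (x ℤ.+ y) ℤ.+ ℤ.- (x′ ℤ.+ y′) ℤ.+ r
  row-+ = ℤ.solve-∀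
  col-+ : ∀ x y r → ℤ.- x ℤ.+ (ℤ.- y ℤ.+ (x ℤ.+ (y ℤ.+ r))) ≡ r
  col-+ = ℤ.solve-∀
  x+y : ∀ i → x i ℤ.+ y i ≡ -1ℤ
  x+y i = cancel (+ (N + (toℕ i + toℕ i)))
    where
    cancel : ∀ a → 1ℤ ℤ.+ a ℤ.+ ℤ.- (+ 2 ℤ.+ a) ≡ -1ℤ
    cancel = ℤ.solve-∀

  old : ∀ {v} → Occurs val v → Occurs val′ v
  old (i , d , eq) = i , suc (suc (suc (suc d))) , eq

  module _ {i} (i<n : i < n) where
    here : ∀ (f : ℕ → ℤ) → f (toℕ (fromℕ< i<n)) ≡ f i
    here f = cong f (Fin.toℕ-fromℕ< i<n)
    there : ∀ (f : ℕ → ℤ) → f (toℕ (shift s (proj₁ (unshift s (fromℕ< i<n))))) ≡ f i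
    there f = cong f (trans (cong toℕ (proj₂ (unshift s (fromℕ< i<n)))) (Fin.toℕ-fromℕ< i<n))

  plus : ∀ {v} → v < N ⊎ (∃ λ z → z < n + n × v ≡ N + z) → Occurs val′ (+ suc v)
  plus (inj₁ v<N) = old (occurs⁺ v<N)
  plus (inj₂ (z , z<2n , refl)) with halve n z<2n
  ... | i , i<n , inj₁ refl = fromℕ< i<n , 2F , here i<n (λ k → + suc (N + (k + k)))
  ... | i , i<n , inj₂ refl = proj₁ (unshift s (fromℕ< i<n)) , 1F ,
    trans (there i<n (λ k → + suc (suc (N + (k + k))))) (cong (+_ ∘ suc) (sym (ℕ.+-suc N (i + i))))

  minus : ∀ {v} → v < N ⊎ (∃ λ z → z < n + n × v ≡ N + z) → Occurs val′ -[1+ v ]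
  minus (inj₁ v<N) = old (occurs⁻ v<N)
  minus (inj₂ (z , z<2n , refl)) with halve n z<2n
  ... | i , i<n , inj₁ refl = proj₁ (unshift s (fromℕ< i<n)) , 0F ,
    there i<n (λ k → -[1+ N + (k + k) ])
  ... | i , i<n , inj₂ refl = fromℕ< i<n , 3F ,
    trans (here i<n (λ k → -[1+ suc (N + (k + k)) ])) (cong -[1+_] (sym (ℕ.+-suc N (i + i))))

-- Zigzag sequences and their adjacent sums

zig : ℕ → ℕ → ℕ → ℕ
zig x y zero = x
zig x y (suc i) = zig y (suc x) i

zig-even : ∀ x y i → zig x y (i + i) ≡ x + i
zig-even x y zero = sym (ℕ.+-identityʳ x)
zig-even x y (suc i) rewrite ℕ.+-suc i i = trans (zig-even (suc x) (suc y) i) (sym (ℕ.+-suc x i))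

zig-odd : ∀ x y i → zig x y (suc (i + i)) ≡ y + i
zig-odd x y i = zig-even y (suc x) i

zig-adjacent : ∀ x y i → zig x y (suc i) + zig x y i ≡ x + y + i
zig-adjacent x y zero = trans (ℕ.+-comm y x) (sym (ℕ.+-identityʳ (x + y)))
zig-adjacent x y (suc i) = trans (zig-adjacent y (suc x) i) (regroup x y i)
  where
  regroup : ∀ x y i → y + suc x + i ≡ x + y + suc i
  regroup = ℕ.solve-∀

join : ℕ → (ℕ → ℕ) → (ℕ → ℕ) → ℕ → ℕ
join zero f g i = g i
join (suc k) f g zero = f zero
join (suc k) f g (suc i) = join k (f ∘ suc) g i

join-< : ∀ k f g {i} → i < k → join k f g i ≡ f i
join-< (suc k) f g {zero} _ = refl
join-< (suc k) f g {suc i} (s≤s i<k) = join-< k (f ∘ suc) g i<k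

join-≥ : ∀ k f g i → join k f g (k + i) ≡ g i
join-≥ zero f g i = refl
join-≥ (suc k) f g i = join-≥ k (f ∘ suc) g i

Takes : (ℕ → ℕ) → ℕ → ℕ → Set
Takes x n y = ∃ λ (i : Fin n) → x (toℕ i) ≡ y

AdjacentSum : (ℕ → ℕ) → ℕ → ℕ → Set
AdjacentSum x n s = ∃ λ (i : Fin n) → x (toℕ i) + x (toℕ (σ i)) ≡ s

takes-at : ∀ (x : ℕ → ℕ) {k y} → k < n → x k ≡ y → Takes x n y
takes-at x k<n eq = fromℕ< k<n , trans (cong x (Fin.toℕ-fromℕ< k<n)) eq

adjacent-at : ∀ (x : ℕ → ℕ) {k s} → suc k < n → x (suc k) + x k ≡ s → AdjacentSum x n s
adjacent-at x {k} k<n eq = fromℕ< k<n , trans (cong₂ _+_ (cong x (Fin.toℕ-fromℕ< k<n))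
  (cong x (toℕ-shift-≥ 1 (fromℕ< k<n) (Fin.toℕ-fromℕ< k<n)))) eq

adjacent-wrap : ∀ (x : ℕ → ℕ) {k s} → n ≡ suc k → x 0 + x k ≡ s → AdjacentSum x n s
adjacent-wrap x {k} refl eq = zero , trans (cong (λ j → x 0 + x j) (Fin.toℕ-fromℕ k)) eq

-- The reflection z = n - 1 - y, for intervals that are filled from the far end.
complement : ∀ {n y} → y < n → ∃ λ z → z < n × z + suc y ≡ n
complement {n} {y} y<n = n ∸ suc y , ℕ.∸-monoʳ-< z<s y<n , ℕ.m∸n+n≡m y<n

-- Three diagonals, n even

off₃ : Vector ℕ 3
off₃ = 0 ∷ 1 ∷ 2 ∷ []

-- The triangle of entries a (i − 1) + κ, r − (a i + a (i − 1) + κ), a i in row i: all rows and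
-- all columns sum to r.
triangle-sum : ∀ p q r → p ℤ.+ (r ℤ.- (q ℤ.+ p) ℤ.+ (q ℤ.+ 0ℤ)) ≡ r
triangle-sum = ℤ.solve-∀

triangle-sum′ : ∀ p q r κ → (p ℤ.+ κ) ℤ.+ (r ℤ.- (p ℤ.+ (q ℤ.+ κ)) ℤ.+ (q ℤ.+ 0ℤ)) ≡ r
triangle-sum′ = ℤ.solve-∀

-- Entries a i = x i − 3m fill −3m … −(m+1), a i + κ fill m+1 … 3m, and the middle entries
-- 2m − 1 − (x i + x (i − 1)) have to fill ±1, …, ±m.
evenThree : ∀ m (x : ℕ → ℕ) → (∀ {y} → y < m + m → Takes x (m + m) y) →
  (∀ {y} → y < m → AdjacentSum x (m + m) (m + m + y)) →
  (∀ {y} → y < m → ∃ λ s → AdjacentSum x (m + m) s × s + suc (suc y) ≡ m + m) →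
  Circulant (m + m) 3 0 (m + (m + m)) off₃
evenThree m x takes high low = record
  { val = val
  ; size = size m
  ; row-zero = λ i → triangle-sum (a (σ i) ℤ.+ κ) (a i) 0ℤ
  ; col-zero = λ j → triangle-sum′ (a (σ j)) (a (σ (σ j))) 0ℤ κ
  ; occurs⁰ = λ ()
  ; occurs⁺ = λ y< → plus (split-< m y<)
  ; occurs⁻ = λ y< → minus (split-< m y<)
  }
  where
  κ : ℤ
  κ = 1ℤ ℤ.+ (+ m ℤ.+ + m ℤ.+ (+ m ℤ.+ + m))
  a : Fin (m + m) → ℤ
  a i = ℤ.- (+ m ℤ.+ (+ m ℤ.+ + m)) ℤ.+ + x (toℕ i)
  val : Fin (m + m) → Vector ℤ 3
  val i = a (σ i) ℤ.+ κ ∷ 0ℤ ℤ.- (a i ℤ.+ (a (σ i) ℤ.+ κ)) ∷ a i ∷ []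

  size : ∀ m → (m + m) * 3 ≡ m + (m + m) + (m + (m + m))
  size = ℕ.solve-∀

  plus : ∀ {y} → y < m ⊎ (∃ λ z → z < m + m × y ≡ m + z) → Occurs val (+ suc y)
  plus {y} (inj₁ y<m) with _ , (i , refl) , eq ← low y<m
    = i , 1F , ℤ-balance (cong +_ (sym eq)) (ring (+ m) (+ x (toℕ i)) (+ x (toℕ (σ i))) (+ y))
    where
    ring : ∀ m p q y →
      0ℤ ℤ.- (ℤ.- (m ℤ.+ (m ℤ.+ m)) ℤ.+ p ℤ.+ (ℤ.- (m ℤ.+ (m ℤ.+ m)) ℤ.+ q
        ℤ.+ (1ℤ ℤ.+ (m ℤ.+ m ℤ.+ (m ℤ.+ m))))) ℤ.+ (p ℤ.+ q ℤ.+ (+ 2 ℤ.+ y))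
      ≡ 1ℤ ℤ.+ y ℤ.+ (m ℤ.+ m)
    ring = ℤ.solve-∀
  plus (inj₂ (z , z< , refl)) with i , eq ← takes z<
    = let j , eq′ = unshift 1 i in j , 0F , trans
        (cong (λ v → ℤ.- (+ m ℤ.+ (+ m ℤ.+ + m)) ℤ.+ + v ℤ.+ κ) (trans (cong (x ∘ toℕ) eq′) eq))
        (ring (+ m) (+ z))
    where
    ring : ∀ m z → ℤ.- (m ℤ.+ (m ℤ.+ m)) ℤ.+ z ℤ.+ (1ℤ ℤ.+ (m ℤ.+ m ℤ.+ (m ℤ.+ m))) ≡ 1ℤ ℤ.+ (m ℤ.+ z)
    ring = ℤ.solve-∀

  minus : ∀ {y} → y < m ⊎ (∃ λ z → z < m + m × y ≡ m + z) → Occurs val -[1+ y ]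
  minus {y} (inj₁ y<m) with i , eq ← high y<m
    = i , 1F , ℤ-balance (cong +_ (sym eq)) (ring (+ m) (+ x (toℕ i)) (+ x (toℕ (σ i))) (+ y))
    where
    ring : ∀ m p q y →
      0ℤ ℤ.- (ℤ.- (m ℤ.+ (m ℤ.+ m)) ℤ.+ p ℤ.+ (ℤ.- (m ℤ.+ (m ℤ.+ m)) ℤ.+ q
        ℤ.+ (1ℤ ℤ.+ (m ℤ.+ m ℤ.+ (m ℤ.+ m))))) ℤ.+ (p ℤ.+ q)
      ≡ ℤ.- (1ℤ ℤ.+ y) ℤ.+ (m ℤ.+ m ℤ.+ y)
    ring = ℤ.solve-∀
  minus (inj₂ (z , z< , refl)) with w , w< , compl ← complement z< with i , eq ← takes w<
    = i , 2F , trans (cong (λ v → ℤ.- (+ m ℤ.+ (+ m ℤ.+ + m)) ℤ.+ + v) eq)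
        (ℤ-balance (cong +_ compl) (ring (+ m) (+ z) (+ w)))
    where
    ring : ∀ m z w → ℤ.- (m ℤ.+ (m ℤ.+ m)) ℤ.+ w ℤ.+ (m ℤ.+ m) ≡ ℤ.- (1ℤ ℤ.+ (m ℤ.+ z)) ℤ.+ (w ℤ.+ (1ℤ ℤ.+ z))
    ring = ℤ.solve-∀

suc-double-< : ∀ {i k} → i < k → suc (i + i) < k + k
suc-double-< {i} {k} i<k = subst (_≤ k + k) (cong suc (ℕ.+-suc i i)) (ℕ.+-mono-≤ i<k i<k)

double-< : ∀ {i k} → i < k → i + i < k + k
double-< i<k = ℕ.<-trans (ℕ.n<1+n _) (suc-double-< i<k)

join-takes-< : ∀ k f g {l i y} → i < k → f i ≡ y → Takes (join k f g) (k + l) y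
join-takes-< k f g {l} i<k eq =
  takes-at (join k f g) (ℕ.<-≤-trans i<k (ℕ.m≤m+n k l)) (trans (join-< k f g i<k) eq)

join-takes-≥ : ∀ k f g {l i y} → i < l → g i ≡ y → Takes (join k f g) (k + l) y
join-takes-≥ k f g {i = i} i<l eq = takes-at (join k f g) (ℕ.+-monoʳ-< k i<l) (trans (join-≥ k f g i) eq)

-- x = 0, m, 1, m+1, …  followed by  m+k, k, m+k+1, k+1, … : a plain zigzag 0, m, 1, m+1, … of
-- even length repeats the adjacent sum m + m − 1 instead of taking m − 1 and 3m − 1.
three-4k : ∀ k′ → let m = suc k′ + suc k′ in Circulant (m + m) 3 0 (m + (m + m)) off₃
three-4k k′ = evenThree m x takes (λ y< → high (ℕ.m<1+n⇒m<n∨m≡n y<)) (λ y< → low (ℕ.m<1+n⇒m<n∨m≡n y<))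
  where
  k m m′ : ℕ
  k = suc k′
  m = k + k
  m′ = k′ + k
  f g x : ℕ → ℕ
  f = zig 0 m
  g = zig (m + k) k
  x = join m f g

  f-last : f m′ ≡ m + k′
  f-last = trans (cong f (ℕ.+-suc k′ k′)) (zig-odd 0 m k′)

  g-last : g m′ ≡ k + k′
  g-last = trans (cong g (ℕ.+-suc k′ k′)) (zig-odd (m + k) k k′)

  takes : ∀ {y} → y < m + m → Takes x (m + m) y
  takes y< with split-< m y<
  takes y< | inj₁ y<m with split-< k y<m
  ... | inj₁ y<k = join-takes-< m f g (double-< y<k) (zig-even 0 m _)
  ... | inj₂ (z , z<k , refl) = join-takes-≥ m f g (suc-double-< z<k) (zig-odd (m + k) k z)
  takes y< | inj₂ (w , w<m , refl) with split-< k w<m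
  ... | inj₁ w<k = join-takes-< m f g (suc-double-< w<k) (zig-odd 0 m w)
  ... | inj₂ (z , z<k , refl) = join-takes-≥ m f g (double-< z<k)
          (trans (zig-even (m + k) k z) (ℕ.+-assoc m k z))

  high : ∀ {y} → y < m′ ⊎ y ≡ m′ → AdjacentSum x (m + m) (m + m + y)
  high {y} (inj₁ y<m′) = adjacent-at x (subst (_< m + m) (ℕ.+-suc m y) (ℕ.+-monoʳ-< m (s<s y<m′)))
    (trans (cong₂ _+_ (trans (cong x (sym (ℕ.+-suc m y))) (join-≥ m f g (suc y))) (join-≥ m f g y))
      (trans (zig-adjacent (m + k) k y) (cong (_+ y) (ℕ.+-assoc m k k))))
  -- The junction from m + k - 1 to m + k supplies the largest sum 3m - 1.
  high (inj₂ refl) = adjacent-at x (ℕ.m<m+n m z<s)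
    (trans (cong₂ _+_ (trans (cong x (sym (ℕ.+-identityʳ m))) (join-≥ m f g 0))
        (trans (join-< m f g (ℕ.n<1+n m′)) f-last))
      (regroup m k′))
    where
    regroup : ∀ m k′ → m + suc k′ + (m + k′) ≡ m + m + (k′ + suc k′)
    regroup = ℕ.solve-∀

  low : ∀ {y} → y < m′ ⊎ y ≡ m′ → ∃ λ s → AdjacentSum x (m + m) s × s + suc (suc y) ≡ m + m
  low {y} (inj₁ y<m′) with z , z<m′ , eq ← complement y<m′
    = m + z
    , adjacent-at x (ℕ.<-≤-trans (s<s z<m′) (ℕ.m≤m+n m m))
        (trans (cong₂ _+_ (join-< m f g (s<s z<m′)) (join-< m f g (ℕ.m<n⇒m<1+n z<m′))) (zig-adjacent 0 m z))
    , trans (regroup m z y) (cong (λ v → m + suc v) eq)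
    where
    regroup : ∀ m z y → m + z + suc (suc y) ≡ m + suc (z + suc y)
    regroup = ℕ.solve-∀
  -- The return from the last term m - 1 to 0 supplies the smallest sum m - 1.
  low (inj₂ refl) = k + k′
    , adjacent-wrap x (ℕ.+-suc m m′) (trans (join-≥ m f g m′) g-last)
    , regroup k′
    where
    regroup : ∀ k′ → suc k′ + k′ + suc (suc (k′ + suc k′)) ≡ suc k′ + suc k′ + (suc k′ + suc k′)
    regroup = ℕ.solve-∀

-- x = 0, m, 1, …, r  followed by  m+r+1, m+r,  by  m+r+2, r+1, m+r+3, …, 2r+1  and by  2r+2.
three-4k+2 : ∀ r → let m = 3 + (r + r) in Circulant (m + m) 3 0 (m + (m + m)) off₃
three-4k+2 r = evenThree m x
  (λ {y} y< → subst (λ n → Takes x n y) n′≡m+m (takes (subst (y <_) (total r) y<)))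
  (λ {y} y< → subst (λ n → AdjacentSum x n (m + m + y)) n′≡m+m
    (high (split-< (suc q) (subst (y <_) (split₁ r) y<))))
  (λ {y} y< → let s , adj , eq = low (split-< 2 (subst (y <_) (split₂ r) y<)) in
    s , subst (λ n → AdjacentSum x n s) n′≡m+m adj , eq)
  where
  q m n′ : ℕ
  q = r + r
  m = 3 + q
  n′ = suc q + (2 + (2 + q + 1))
  mid f g rest₁ rest₂ x : ℕ → ℕ
  mid zero = m + r + 1
  mid (suc _) = m + r
  f = zig 0 m
  g = zig (m + r + 2) (suc r)
  rest₂ = join (2 + q) g (λ _ → 2 + q)
  rest₁ = join 2 mid rest₂
  x = join (suc q) f rest₁

  -- The runs of 0 ... 2m - 1 as `takes` meets them: 0 ... r at the even places of `f`, r + 1 ... 2r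
  -- + 1 at the odd places of `g`, the final term 2r + 2; then m ... m + r - 1 at the odd places of
  -- `f`, the pair `mid`, and the rest at the even places of `g`.
  total : ∀ r → 3 + (r + r) + (3 + (r + r)) ≡ suc r + (suc r + 1) + (r + (1 + (1 + suc r)))
  total = ℕ.solve-∀
  split₁ : ∀ r → 3 + (r + r) ≡ suc (r + r) + 2
  split₁ = ℕ.solve-∀
  split₂ : ∀ r → 3 + (r + r) ≡ 2 + (r + r + 1)
  split₂ = ℕ.solve-∀
  n′≡m+m : n′ ≡ m + m
  n′≡m+m = regroup r
    where
    regroup : ∀ r → suc (r + r) + (2 + (2 + (r + r) + 1)) ≡ 3 + (r + r) + (3 + (r + r))
    regroup = ℕ.solve-∀

  x-< : ∀ {i} → i < suc q → x i ≡ f i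
  x-< = join-< (suc q) f rest₁
  x-mid : ∀ i → i < 2 → x (suc q + i) ≡ mid i
  x-mid i i<2 = trans (join-≥ (suc q) f rest₁ i) (join-< 2 mid rest₂ i<2)
  x-≥ : ∀ {i} → i < 2 + q → x (suc q + (2 + i)) ≡ g i
  x-≥ {i} i< = trans (join-≥ (suc q) f rest₁ (2 + i))
    (trans (join-≥ 2 mid rest₂ i) (join-< (2 + q) g (λ _ → 2 + q) i<))
  x-last : x (suc q + (2 + (2 + q + 0))) ≡ 2 + q
  x-last = trans (join-≥ (suc q) f rest₁ (2 + (2 + q + 0))) (join-≥ (2 + q) g (λ _ → 2 + q) 0)

  bound : ∀ {i} → i < 2 + (2 + q + 1) → suc q + i < n′
  bound = ℕ.+-monoʳ-< (suc q)
  bound-≥ : ∀ {i} → i < 2 + q → suc q + (2 + i) < n′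
  bound-≥ i< = bound (s<s (s<s (ℕ.<-≤-trans i< (ℕ.m≤m+n (2 + q) 1))))

  takes : ∀ {y} → y < suc r + (suc r + 1) + (r + (1 + (1 + suc r))) → Takes x n′ y
  takes y< with split-< (suc r + (suc r + 1)) y<
  takes y< | inj₁ y<m with split-< (suc r) y<m
  ... | inj₁ y≤r = takes-at x (ℕ.<-≤-trans (s<s (ℕ.+-mono-≤ (ℕ.s≤s⁻¹ y≤r) (ℕ.s≤s⁻¹ y≤r))) (ℕ.m≤m+n (suc q) _))
          (trans (x-< (s<s (ℕ.+-mono-≤ (ℕ.s≤s⁻¹ y≤r) (ℕ.s≤s⁻¹ y≤r)))) (zig-even 0 m _))
  ... | inj₂ (w , w< , refl) with split-< (suc r) w<
  ... | inj₁ w≤r = takes-at x (bound-≥ w-bound) (trans (x-≥ w-bound) (zig-odd (m + r + 2) (suc r) w))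
    where
    w-bound : suc (w + w) < 2 + q
    w-bound = s<s (s<s (ℕ.+-mono-≤ (ℕ.s≤s⁻¹ w≤r) (ℕ.s≤s⁻¹ w≤r)))
  ... | inj₂ (zero , _ , refl) = takes-at x (bound (s<s (s<s (ℕ.+-monoʳ-< (2 + q) z<s))))
          (trans x-last (regroup r))
    where
    regroup : ∀ r → 2 + (r + r) ≡ suc r + (suc r + 0)
    regroup = ℕ.solve-∀
  ... | inj₂ (suc _ , s≤s () , _)
  takes y< | inj₂ (w , w< , refl) with split-< r w<
  ... | inj₁ w<r = takes-at x (ℕ.<-≤-trans (ℕ.m<n⇒m<1+n (suc-double-< w<r)) (ℕ.m≤m+n (suc q) _))
          (trans (x-< (ℕ.m<n⇒m<1+n (suc-double-< w<r))) (trans (zig-odd 0 m w) (regroup r w)))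
    where
    regroup : ∀ r w → 3 + (r + r) + w ≡ suc r + (suc r + 1) + w
    regroup = ℕ.solve-∀
  ... | inj₂ (zero , _ , refl) = takes-at x (bound (s<s z<s)) (trans (x-mid 1 (s<s z<s)) (regroup r))
    where
    regroup : ∀ r → 3 + (r + r) + r ≡ suc r + (suc r + 1) + (r + 0)
    regroup = ℕ.solve-∀
  ... | inj₂ (suc zero , _ , refl) = takes-at x (bound z<s) (trans (x-mid 0 z<s) (regroup r))
    where
    regroup : ∀ r → 3 + (r + r) + r + 1 ≡ suc r + (suc r + 1) + (r + 1)
    regroup = ℕ.solve-∀
  ... | inj₂ (suc (suc z) , s≤s (s≤s z≤r) , refl) =
          takes-at x (bound-≥ z-bound)
            (trans (x-≥ z-bound) (trans (zig-even (m + r + 2) (suc r) z) (regroup r z)))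
    where
    z-bound : z + z < 2 + q
    z-bound = ℕ.m<n⇒m<1+n (s<s (ℕ.+-mono-≤ (ℕ.s≤s⁻¹ z≤r) (ℕ.s≤s⁻¹ z≤r)))
    regroup : ∀ r z → 3 + (r + r) + r + 2 + z ≡ suc r + (suc r + 1) + (r + suc (suc z))
    regroup = ℕ.solve-∀

  high : ∀ {y} → y < suc q ⊎ (∃ λ z → z < 2 × y ≡ suc q + z) → AdjacentSum x n′ (m + m + y)
  high {y} (inj₁ y<) = adjacent-at x (subst (_< n′) (ℕ.+-suc (suc q) (2 + y)) (bound-≥ (s<s y<)))
    (trans (cong₂ _+_ (trans (cong x (sym (ℕ.+-suc (suc q) (2 + y)))) (x-≥ (s<s y<))) (x-≥ (ℕ.m<n⇒m<1+n y<)))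
      (trans (zig-adjacent (m + r + 2) (suc r) y) (regroup r y)))
    where
    regroup : ∀ r y → 3 + (r + r) + r + 2 + suc r + y ≡ 3 + (r + r) + (3 + (r + r)) + y
    regroup = ℕ.solve-∀
  -- The descending pair m + r + 1, m + r supplies 3m - 2, and the step from it to m + r + 2
  -- supplies 3m - 1; the sums within `g` stop at 3m - 3.
  high (inj₂ (zero , _ , refl)) = adjacent-at x (subst (_< n′) (ℕ.+-suc (suc q) 0) (bound (s<s z<s)))
    (trans (cong₂ _+_ (trans (cong x (sym (ℕ.+-suc (suc q) 0))) (x-mid 1 (s<s z<s))) (x-mid 0 z<s)) (regroup r))
    where
    regroup : ∀ r → 3 + (r + r) + r + (3 + (r + r) + r + 1) ≡ 3 + (r + r) + (3 + (r + r)) + (suc (r + r) + 0)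
    regroup = ℕ.solve-∀
  high (inj₂ (suc zero , _ , refl)) = adjacent-at x (subst (_< n′) (ℕ.+-suc (suc q) 1) (bound-≥ z<s))
    (trans (cong₂ _+_ (trans (cong x (sym (ℕ.+-suc (suc q) 1))) (x-≥ z<s)) (x-mid 1 (s<s z<s))) (regroup r))
    where
    regroup : ∀ r → 3 + (r + r) + r + 2 + (3 + (r + r) + r) ≡ 3 + (r + r) + (3 + (r + r)) + (suc (r + r) + 1)
    regroup = ℕ.solve-∀
  high (inj₂ (suc (suc _) , s≤s (s≤s ()) , _))

  -- The zigzag `f` supplies the sums m ... 2m - 4. The missing 2m - 2, 2m - 3 and m - 1 come from
  -- the steps r to m + r + 1, 2r + 1 to 2r + 2, and 2r + 2 back to 0.
  low : ∀ {y} → y < 2 ⊎ (∃ λ z → z < q + 1 × y ≡ 2 + z) →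
    ∃ λ s → AdjacentSum x n′ s × s + suc (suc y) ≡ m + m
  low {zero} (inj₁ _) = _
    , adjacent-at x (subst (_< n′) (ℕ.+-identityʳ (suc q)) (bound z<s))
        (cong₂ _+_ (trans (cong x (sym (ℕ.+-identityʳ (suc q)))) (x-mid 0 z<s))
          (trans (x-< (ℕ.n<1+n q)) (zig-even 0 m r)))
    , regroup r
    where
    regroup : ∀ r → 3 + (r + r) + r + 1 + r + 2 ≡ 3 + (r + r) + (3 + (r + r))
    regroup = ℕ.solve-∀
  low {suc zero} (inj₁ _) = _
    , adjacent-at x (subst (_< n′) shape (bound (s<s (s<s (ℕ.+-monoʳ-< (2 + q) z<s)))))
        (cong₂ _+_ (trans (cong x (sym shape)) x-last)
          (trans (x-≥ (ℕ.n<1+n (suc q))) (zig-odd (m + r + 2) (suc r) r)))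
    , regroup r
    where
    shape : suc q + (2 + (2 + q + 0)) ≡ suc (suc q + (2 + suc q))
    shape = trans (cong (λ v → suc q + (2 + v)) (ℕ.+-identityʳ (2 + q))) (ℕ.+-suc (suc q) (2 + suc q))
    regroup : ∀ r → 2 + (r + r) + (suc r + r) + 3 ≡ 3 + (r + r) + (3 + (r + r))
    regroup = ℕ.solve-∀
  low {suc (suc _)} (inj₁ (s≤s (s≤s ())))
  low (inj₂ (z , z< , refl)) with split-< q z<
  ... | inj₁ z<q with w , w<q , eq ← complement z<q
    = m + w
    , adjacent-at x (ℕ.<-≤-trans (s<s w<q) (ℕ.m≤m+n (suc q) _))
        (trans (cong₂ _+_ (x-< (s<s w<q)) (x-< (ℕ.m<n⇒m<1+n w<q))) (zig-adjacent 0 m w))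
    , trans (regroup m w z) (cong (λ v → m + (3 + v)) eq)
    where
    regroup : ∀ m w z → m + w + (4 + z) ≡ m + (3 + (w + suc z))
    regroup = ℕ.solve-∀
  ... | inj₂ (zero , _ , refl) = 2 + q
    , adjacent-wrap x shape x-last
    , regroup r
    where
    shape : n′ ≡ suc (suc q + (2 + (2 + q + 0)))
    shape = trans (cong (λ v → suc q + (2 + v)) (ℕ.+-suc (2 + q) 0)) (ℕ.+-suc (suc q) (2 + (2 + q + 0)))
    regroup : ∀ r → 2 + (r + r) + (4 + (r + r + 0)) ≡ 3 + (r + r) + (3 + (r + r))
    regroup = ℕ.solve-∀
  ... | inj₂ (suc _ , s≤s () , _)

-- Three and six diagonals, n odd

toℕ-σ-suc : ∀ (i : Fin n) → toℕ (σ (suc i)) ≡ toℕ i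
toℕ-σ-suc = Fin.toℕ-inject₁

fiber : ∀ k {y} → y < n → ∃ λ (i : Fin n) → toℕ (shift k i) ≡ y
fiber k y<n with i , eq ← unshift k (fromℕ< y<n) = i , trans (cong toℕ eq) (Fin.toℕ-fromℕ< y<n)

takes-shifted : ∀ k x {y} → Takes x n y → ∃ λ (i : Fin n) → x (toℕ (shift k i)) ≡ y
takes-shifted k x (i , eq) with j , eq′ ← unshift k i = j , trans (cong (x ∘ toℕ) eq′) eq

zig-takes : ∀ m {y} → y < suc (m + m) → Takes (zig 0 (suc m)) (suc (m + m)) y
zig-takes m y< with split-< (suc m) y<
... | inj₁ y≤m = takes-at (zig 0 (suc m)) (s<s (ℕ.+-mono-≤ (ℕ.s≤s⁻¹ y≤m) (ℕ.s≤s⁻¹ y≤m))) (zig-even 0 (suc m) _)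
... | inj₂ (w , w<m , refl) = takes-at (zig 0 (suc m)) (ℕ.m<n⇒m<1+n (suc-double-< w<m)) (zig-odd 0 (suc m) w)

-- A zigzag of odd length stops at the even place 2m, on the value m. The wrap-around sum is
-- therefore 0 + m, just below the first inner sum m + 1, and all cyclic sums are consecutive.
zig-cyclic : ∀ m (i : Fin (suc (m + m))) →
  zig 0 (suc m) (toℕ i) + zig 0 (suc m) (toℕ (σ i)) ≡ m + toℕ i
zig-cyclic m zero = trans (cong (zig 0 (suc m)) (Fin.toℕ-fromℕ (m + m)))
  (trans (zig-even 0 (suc m) m) (sym (ℕ.+-identityʳ m)))
zig-cyclic m (suc i) = trans (cong (λ j → zig 0 (suc m) (suc (toℕ i)) + zig 0 (suc m) j) (toℕ-σ-suc i))
  (trans (zig-adjacent 0 (suc m) (toℕ i)) (sym (ℕ.+-suc m (toℕ i))))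

-- `a` fills -(3m + 1) ... -(m + 1), its translate by `κ` fills m + 1 ... 3m + 1, and the middle
-- entry m - i runs from m down to -m.
module OddThree (m : ℕ) where
  n₁ : ℕ
  n₁ = suc (m + m)
  z : ℕ → ℕ
  z = zig 0 (suc m)
  κ : ℤ
  κ = + 2 ℤ.+ (+ m ℤ.+ + m ℤ.+ (+ m ℤ.+ + m))
  a b : Fin n₁ → ℤ
  a i = ℤ.- (1ℤ ℤ.+ (+ m ℤ.+ (+ m ℤ.+ + m))) ℤ.+ + z (toℕ i)
  b i = 0ℤ ℤ.- (a i ℤ.+ (a (σ i) ℤ.+ κ))

  b-value : ∀ i → b i ≡ + m ℤ.- + toℕ i
  b-value i = ℤ-balance (cong +_ (sym (zig-cyclic m i)))
    (ring (+ m) (+ z (toℕ i)) (+ z (toℕ (σ i))) (+ toℕ i))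
    where
    ring : ∀ m p q i →
      0ℤ ℤ.- (ℤ.- (1ℤ ℤ.+ (m ℤ.+ (m ℤ.+ m))) ℤ.+ p ℤ.+ (ℤ.- (1ℤ ℤ.+ (m ℤ.+ (m ℤ.+ m))) ℤ.+ q
        ℤ.+ (+ 2 ℤ.+ (m ℤ.+ m ℤ.+ (m ℤ.+ m))))) ℤ.+ (p ℤ.+ q) ≡ m ℤ.- i ℤ.+ (m ℤ.+ i)
    ring = ℤ.solve-∀

  val : Fin n₁ → Vector ℤ 3
  val i = a (σ i) ℤ.+ κ ∷ b i ∷ a i ∷ []

  middle : ∀ {k v} → k < n₁ → + m ℤ.- + k ≡ v → Occurs val v
  middle k< eq = fromℕ< k< , 1F , trans (b-value (fromℕ< k<))
    (trans (cong (λ j → + m ℤ.- + j) (Fin.toℕ-fromℕ< k<)) eq)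

  plus : ∀ {y} → y < m ⊎ (∃ λ w → w < n₁ × y ≡ m + w) → Occurs val (+ suc y)
  plus {y} (inj₁ y<m) with w , w<m , eq ← complement y<m
    = middle (ℕ.<-≤-trans w<m (ℕ.m≤n⇒m≤1+n (ℕ.m≤m+n m m)))
        (ℤ-balance (cong +_ (sym eq)) (ring (+ m) (+ w) (+ y)))
    where
    ring : ∀ m w y → m ℤ.- w ℤ.+ (w ℤ.+ (1ℤ ℤ.+ y)) ≡ 1ℤ ℤ.+ y ℤ.+ m
    ring = ℤ.solve-∀
  plus (inj₂ (w , w< , refl)) with i , eq ← takes-shifted 1 z (zig-takes m w<)
    = i , 0F , trans (cong (λ v → ℤ.- (1ℤ ℤ.+ (+ m ℤ.+ (+ m ℤ.+ + m))) ℤ.+ + v ℤ.+ κ) eq) (ring (+ m) (+ w))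
    where
    ring : ∀ m w → ℤ.- (1ℤ ℤ.+ (m ℤ.+ (m ℤ.+ m))) ℤ.+ w ℤ.+ (+ 2 ℤ.+ (m ℤ.+ m ℤ.+ (m ℤ.+ m))) ≡ 1ℤ ℤ.+ (m ℤ.+ w)
    ring = ℤ.solve-∀

  minus : ∀ {y} → y < m ⊎ (∃ λ w → w < n₁ × y ≡ m + w) → Occurs val -[1+ y ]
  minus {y} (inj₁ y<m) = middle {k = suc (m + y)} (s<s (ℕ.+-monoʳ-< m y<m)) (ring (+ m) (+ y))
    where
    ring : ∀ m y → m ℤ.- (1ℤ ℤ.+ (m ℤ.+ y)) ≡ ℤ.- (1ℤ ℤ.+ y)
    ring = ℤ.solve-∀
  minus (inj₂ (w , w< , refl)) with u , u< , compl ← complement w< with i , eq ← zig-takes m u<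
    = i , 2F , trans (cong (λ v → ℤ.- (1ℤ ℤ.+ (+ m ℤ.+ (+ m ℤ.+ + m))) ℤ.+ + v) eq)
        (ℤ-balance (cong +_ compl) (ring (+ m) (+ w) (+ u)))
    where
    ring : ∀ m w u → ℤ.- (1ℤ ℤ.+ (m ℤ.+ (m ℤ.+ m))) ℤ.+ u ℤ.+ (1ℤ ℤ.+ (m ℤ.+ m))
      ≡ ℤ.- (1ℤ ℤ.+ (m ℤ.+ w)) ℤ.+ (u ℤ.+ (1ℤ ℤ.+ w))
    ring = ℤ.solve-∀

  three-odd : Circulant n₁ 3 1 (m + n₁) off₃
  three-odd = record
    { val = val
    ; size = size m
    ; row-zero = λ i → triangle-sum (a (σ i) ℤ.+ κ) (a i) 0ℤ
    ; col-zero = λ j → triangle-sum′ (a (σ j)) (a (σ (σ j))) 0ℤ κ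
    ; occurs⁰ = λ _ → middle {k = m} (s<s (ℕ.m≤m+n m m)) (ℤ.+-inverseʳ (+ m))
    ; occurs⁺ = λ y< → plus (split-< m y<)
    ; occurs⁻ = λ y< → minus (split-< m y<)
    }
    where
    size : ∀ m → suc (m + m) * 3 ≡ 1 + (m + suc (m + m) + (m + suc (m + m)))
    size = ℕ.solve-∀

off₆ : Vector ℕ 6
off₆ = 0 ∷ 1 ∷ 2 ∷ 3 ∷ 4 ∷ 5 ∷ []

-- A triangle with row and column sums r together with its negative on the next three diagonals.
module OddSix (m : ℕ) where
  n₁ : ℕ
  n₁ = suc (m + m)
  z : ℕ → ℕ
  z = zig 0 (suc m)
  κ r : ℤ
  κ = + n₁
  -- The common sum `r` is free, since the negative copy cancels it; this choice makes b i = -(i +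
  -- 1), just below the absolute values of `a` and of its translate by `κ`.
  r = 1ℤ ℤ.+ (+ n₁ ℤ.+ + n₁ ℤ.+ + n₁ ℤ.+ + m)
  a b : Fin n₁ → ℤ
  a i = 1ℤ ℤ.+ (+ n₁ ℤ.+ + z (toℕ i))
  b i = r ℤ.- (a i ℤ.+ (a (σ i) ℤ.+ κ))

  b-value : ∀ i → b i ≡ -[1+ toℕ i ]
  b-value i = ℤ-balance (cong +_ (sym (zig-cyclic m i)))
    (ring (+ n₁) (+ m) (+ z (toℕ i)) (+ z (toℕ (σ i))) (+ toℕ i))
    where
    ring : ∀ n m p q i →
      1ℤ ℤ.+ (n ℤ.+ n ℤ.+ n ℤ.+ m) ℤ.- (1ℤ ℤ.+ (n ℤ.+ p) ℤ.+ (1ℤ ℤ.+ (n ℤ.+ q) ℤ.+ n)) ℤ.+ (p ℤ.+ q)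
      ≡ ℤ.- (1ℤ ℤ.+ i) ℤ.+ (m ℤ.+ i)
    ring = ℤ.solve-∀

  val : Fin n₁ → Vector ℤ 6
  val i = a (σ i) ℤ.+ κ ∷ b i ∷ a i ∷ ℤ.- (a (σ i) ℤ.+ κ) ∷ ℤ.- b i ∷ ℤ.- a i ∷ []

  both : ∀ {y} → y < n₁ ⊎ (∃ λ w → w < n₁ + n₁ × y ≡ n₁ + w) → Occurs val (+ suc y) × Occurs val -[1+ y ]
  both (inj₁ y<) = (i , 4F , cong ℤ.-_ eq) , (i , 1F , eq)
    where
    i : Fin n₁
    i = fromℕ< y<
    eq : b i ≡ -[1+ _ ]
    eq = trans (b-value i) (cong -[1+_] (Fin.toℕ-fromℕ< y<))
  both (inj₂ (w , w< , refl)) with split-< n₁ w<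
  ... | inj₁ w<n with i , eq ← zig-takes m w<n
    = (i , 2F , eq′) , (i , 5F , cong ℤ.-_ eq′)
    where
    eq′ : a i ≡ + suc (n₁ + w)
    eq′ = cong (λ v → + suc (n₁ + v)) eq
  ... | inj₂ (v , v<n , refl) with i , eq ← takes-shifted 1 z (zig-takes m v<n)
    = (i , 0F , eq′) , (i , 3F , cong ℤ.-_ eq′)
    where
    ring : ∀ n v → 1ℤ ℤ.+ (n ℤ.+ v) ℤ.+ n ≡ 1ℤ ℤ.+ (n ℤ.+ (n ℤ.+ v))
    ring = ℤ.solve-∀
    eq′ : a (σ i) ℤ.+ κ ≡ + suc (n₁ + (n₁ + v))
    eq′ = trans (cong (λ v → 1ℤ ℤ.+ (+ n₁ ℤ.+ + v) ℤ.+ κ) eq) (ring (+ n₁) (+ v))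

  six-odd : Circulant n₁ 6 0 (n₁ + (n₁ + n₁)) off₆
  six-odd = record
    { val = val
    ; size = size n₁
    ; row-zero = λ i → row-+ (a (σ i) ℤ.+ κ) (b i) (a i)
    ; col-zero = λ j → col-+ (a (shift 1 j)) (a (shift 2 j)) (a (shift 4 j)) (a (shift 5 j)) r κ
    ; occurs⁰ = λ ()
    ; occurs⁺ = λ y< → proj₁ (both (split-< n₁ y<))
    ; occurs⁻ = λ y< → proj₂ (both (split-< n₁ y<))
    }
    where
    size : ∀ n → n * 6 ≡ n + (n + n) + (n + (n + n))
    size = ℕ.solve-∀
    row-+ : ∀ p q r → p ℤ.+ (q ℤ.+ (r ℤ.+ (ℤ.- p ℤ.+ (ℤ.- q ℤ.+ (ℤ.- r ℤ.+ 0ℤ))))) ≡ 0ℤ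
    row-+ = ℤ.solve-∀
    col-+ : ∀ p q p′ q′ r κ → (p ℤ.+ κ) ℤ.+ (r ℤ.- (p ℤ.+ (q ℤ.+ κ)) ℤ.+ (q ℤ.+
      (ℤ.- (p′ ℤ.+ κ) ℤ.+ (ℤ.- (r ℤ.- (p′ ℤ.+ (q′ ℤ.+ κ))) ℤ.+ (ℤ.- q′ ℤ.+ 0ℤ))))) ≡ 0ℤ
    col-+ = ℤ.solve-∀

-- Five diagonals

-- Two systems centred on the same diagonal: entries u i, u (i − 1) + K as for t = 3, and
-- v i, v (i − q) + L with v decreasing. With n = n₁ the values u, u + K, v, v + L fill the numbers
-- of absolute value m+1 … m+2n, and the central entry is i + (i − q) − x i − x (i − 1).
module Five (ε m q : ℕ) (x : ℕ → ℕ) (takes : ∀ {y} → y < ε + (m + m) → Takes x (ε + (m + m)) y) where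
  n₁ N₁ : ℕ
  n₁ = ε + (m + m)
  N₁ = m + (n₁ + n₁)

  indices entries : Fin n₁ → ℕ
  indices i = toℕ i + toℕ (shift q i)
  entries i = x (toℕ i) + x (toℕ (σ i))

  U K V L : ℤ
  -- The constants put the four families on their intervals and satisfy 2U + K + 2V + L = 0, so no
  -- constant survives in `b-value`.
  U = ℤ.- (+ n₁ ℤ.+ + m)
  K = 1ℤ ℤ.+ (+ n₁ ℤ.+ (+ m ℤ.+ + m))
  V = ℤ.- (1ℤ ℤ.+ (+ n₁ ℤ.+ + m))
  L = 1ℤ ℤ.+ (+ n₁ ℤ.+ + n₁ ℤ.+ + n₁ ℤ.+ (+ m ℤ.+ + m))

  u v b : Fin n₁ → ℤ
  u i = U ℤ.+ + x (toℕ i)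
  v i = V ℤ.- + toℕ i
  b i = ℤ.- (u i ℤ.+ (u (σ i) ℤ.+ K) ℤ.+ (v i ℤ.+ (v (shift q i) ℤ.+ L)))

  b-value : ∀ i → b i ≡ + indices i ℤ.- + entries i
  b-value i = ring (+ n₁) (+ m) (+ x (toℕ i)) (+ x (toℕ (σ i))) (+ toℕ i) (+ toℕ (shift q i))
    where
    ring : ∀ n m p q i j →
      ℤ.- (ℤ.- (n ℤ.+ m) ℤ.+ p ℤ.+ (ℤ.- (n ℤ.+ m) ℤ.+ q ℤ.+ (1ℤ ℤ.+ (n ℤ.+ (m ℤ.+ m))))
        ℤ.+ (ℤ.- (1ℤ ℤ.+ (n ℤ.+ m)) ℤ.- i ℤ.+ (ℤ.- (1ℤ ℤ.+ (n ℤ.+ m)) ℤ.- j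
          ℤ.+ (1ℤ ℤ.+ (n ℤ.+ n ℤ.+ n ℤ.+ (m ℤ.+ m)))))) ≡ i ℤ.+ j ℤ.- (p ℤ.+ q)
    ring = ℤ.solve-∀

  val : Fin n₁ → Vector ℤ 5
  val i = v (shift q i) ℤ.+ L ∷ u (σ i) ℤ.+ K ∷ b i ∷ u i ∷ v i ∷ []

  module _
    (central⁰ : Fin ε → ∃ λ i → indices i ≡ entries i)
    (central⁺ : ∀ {y} → y < m → ∃ λ i → indices i ≡ entries i + suc y)
    (central⁻ : ∀ {y} → y < m → ∃ λ i → indices i + suc y ≡ entries i)
    where

    zero-central : Fin ε → Occurs val 0ℤ
    zero-central k with i , eq ← central⁰ k = i , 2F , trans (b-value i)
      (trans (cong (λ s → + s ℤ.- + entries i) eq) (ℤ.+-inverseʳ (+ entries i)))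

    plus : ∀ {y} → y < m ⊎ (∃ λ w → w < n₁ + n₁ × y ≡ m + w) → Occurs val (+ suc y)
    plus {y} (inj₁ y<m) with i , eq ← central⁺ y<m = i , 2F , trans (b-value i)
      (trans (cong (λ s → + s ℤ.- + entries i) eq) (ring (+ entries i) (+ y)))
      where
      ring : ∀ e y → e ℤ.+ (1ℤ ℤ.+ y) ℤ.- e ≡ 1ℤ ℤ.+ y
      ring = ℤ.solve-∀
    plus (inj₂ (w , w< , refl)) with split-< n₁ w<
    ... | inj₁ w<n with i , eq ← takes-shifted 1 x (takes w<n) =
      i , 1F , trans (cong (λ s → U ℤ.+ + s ℤ.+ K) eq) (ring (+ n₁) (+ m) (+ w))
      where
      ring : ∀ n m w → ℤ.- (n ℤ.+ m) ℤ.+ w ℤ.+ (1ℤ ℤ.+ (n ℤ.+ (m ℤ.+ m))) ≡ 1ℤ ℤ.+ (m ℤ.+ w)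
      ring = ℤ.solve-∀
    ... | inj₂ (z , z<n , refl) with c , c< , compl ← complement z<n with i , eq ← fiber q c< =
      i , 0F , trans (cong (λ s → V ℤ.- + s ℤ.+ L) eq)
        (ℤ-balance (cong +_ (sym compl)) (ring (+ n₁) (+ m) (+ z) (+ c)))
      where
      ring : ∀ n m z c → ℤ.- (1ℤ ℤ.+ (n ℤ.+ m)) ℤ.- c ℤ.+ (1ℤ ℤ.+ (n ℤ.+ n ℤ.+ n ℤ.+ (m ℤ.+ m)))
        ℤ.+ (c ℤ.+ (1ℤ ℤ.+ z)) ≡ 1ℤ ℤ.+ (m ℤ.+ (n ℤ.+ z)) ℤ.+ n
      ring = ℤ.solve-∀

    minus : ∀ {y} → y < m ⊎ (∃ λ w → w < n₁ + n₁ × y ≡ m + w) → Occurs val -[1+ y ]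
    minus {y} (inj₁ y<m) with i , eq ← central⁻ y<m = i , 2F , trans (b-value i)
      (ℤ-balance (cong +_ eq) (ring (+ indices i) (+ entries i) (+ y)))
      where
      ring : ∀ s e y → s ℤ.- e ℤ.+ e ≡ ℤ.- (1ℤ ℤ.+ y) ℤ.+ (s ℤ.+ (1ℤ ℤ.+ y))
      ring = ℤ.solve-∀
    minus (inj₂ (w , w< , refl)) with split-< n₁ w<
    ... | inj₁ w<n with c , c< , compl ← complement w<n with i , eq ← takes c< =
      i , 3F , trans (cong (λ s → U ℤ.+ + s) eq) (ℤ-balance (cong +_ compl) (ring (+ n₁) (+ m) (+ w) (+ c)))
      where
      ring : ∀ n m w c → ℤ.- (n ℤ.+ m) ℤ.+ c ℤ.+ n ≡ ℤ.- (1ℤ ℤ.+ (m ℤ.+ w)) ℤ.+ (c ℤ.+ (1ℤ ℤ.+ w))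
      ring = ℤ.solve-∀
    ... | inj₂ (z , z<n , refl) =
      fromℕ< z<n , 4F , trans (cong (λ s → V ℤ.- + s) (Fin.toℕ-fromℕ< z<n)) (ring (+ n₁) (+ m) (+ z))
      where
      ring : ∀ n m z → ℤ.- (1ℤ ℤ.+ (n ℤ.+ m)) ℤ.- z ≡ ℤ.- (1ℤ ℤ.+ (m ℤ.+ (n ℤ.+ z)))
      ring = ℤ.solve-∀

    -- In each column the four outer entries must be those that the central entry on diagonal o₂
    -- cancels. The conditions compare rows modulo `n` and not offsets, because in the even case o₀
    -- + q reaches o₂ only after a full turn.
    five : ∀ {o₀ o₁ o₂ o₃ o₄} →
      (∀ (j : Fin n₁) → shift q (shift o₀ j) ≡ shift o₂ j) → (∀ (j : Fin n₁) → σ (shift o₁ j) ≡ shift o₂ j) →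
      (∀ (j : Fin n₁) → shift o₃ j ≡ σ (shift o₂ j)) → (∀ (j : Fin n₁) → shift o₄ j ≡ shift q (shift o₂ j)) →
      Circulant n₁ 5 ε N₁ (o₀ ∷ o₁ ∷ o₂ ∷ o₃ ∷ o₄ ∷ [])
    five {o₀} {o₁} {o₂} {o₃} {o₄} c₀ c₁ c₃ c₄ = record
      { val = val
      ; size = size ε m
      ; row-zero = λ i → row-+ (u i) (u (σ i) ℤ.+ K) (v i) (v (shift q i) ℤ.+ L)
      ; col-zero = col-zero
      ; occurs⁰ = zero-central
      ; occurs⁺ = λ y< → plus (split-< m y<)
      ; occurs⁻ = λ y< → minus (split-< m y<)
      }
      where
      size : ∀ ε m → let n = ε + (m + m) in n * 5 ≡ ε + (m + (n + n) + (m + (n + n)))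
      size = ℕ.solve-∀
      row-+ : ∀ p q r s → s ℤ.+ (q ℤ.+ (ℤ.- (p ℤ.+ q ℤ.+ (r ℤ.+ s)) ℤ.+ (p ℤ.+ (r ℤ.+ 0ℤ)))) ≡ 0ℤ
      row-+ = ℤ.solve-∀
      col-+ : ∀ p p′ r r′ k l → (r ℤ.+ l) ℤ.+ (p ℤ.+ k ℤ.+ (ℤ.- (p ℤ.+ (p′ ℤ.+ k) ℤ.+ (r ℤ.+ (r′ ℤ.+ l)))
        ℤ.+ (p′ ℤ.+ (r′ ℤ.+ 0ℤ)))) ≡ 0ℤ
      col-+ = ℤ.solve-∀
      col-zero : ∀ j → v (shift q (shift o₀ j)) ℤ.+ L ℤ.+ (u (σ (shift o₁ j)) ℤ.+ K ℤ.+ (b (shift o₂ j)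
        ℤ.+ (u (shift o₃ j) ℤ.+ (v (shift o₄ j) ℤ.+ 0ℤ)))) ≡ 0ℤ
      col-zero j rewrite c₀ j | c₁ j | c₃ j | c₄ j = let c = shift o₂ j in
        col-+ (u c) (u (σ c)) (v c) (v (shift q c)) K L

off₅ : Vector ℕ 5
off₅ = 0 ∷ 1 ∷ 2 ∷ 3 ∷ 4 ∷ []

-- Lag 2 puts the five diagonals side by side. As the cyclic sums of the zigzag are m + i, the
-- central entry is (i - 2 mod n) - m and runs over -m ... m.
five-odd : ∀ m → Circulant (suc (m + m)) 5 1 (m + (suc (m + m) + suc (m + m))) off₅
five-odd m = five central⁰ central⁺ central⁻ (λ _ → refl) (λ _ → refl) (λ _ → refl) (λ _ → refl)
  where
  open Five 1 m 2 (zig 0 (suc m)) (zig-takes m)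

  entries-value : ∀ i → entries i ≡ m + toℕ i
  entries-value = zig-cyclic m

  central⁰ : Fin 1 → ∃ λ i → indices i ≡ entries i
  central⁰ _ with i , eq ← fiber {suc (m + m)} 2 {m} (s<s (ℕ.m≤m+n m m)) =
    i , trans (cong (_+_ (toℕ i)) eq) (trans (ℕ.+-comm (toℕ i) m) (sym (entries-value i)))

  central⁺ : ∀ {y} → y < m → ∃ λ i → indices i ≡ entries i + suc y
  central⁺ {y} y<m with i , eq ← fiber {suc (m + m)} 2 {suc (m + y)} (s<s (ℕ.+-monoʳ-< m y<m)) =
    i , trans (cong (_+_ (toℕ i)) eq) (trans (regroup (toℕ i) m y) (cong (_+ suc y) (sym (entries-value i))))
    where
    regroup : ∀ i m y → i + suc (m + y) ≡ m + i + suc y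
    regroup = ℕ.solve-∀

  central⁻ : ∀ {y} → y < m → ∃ λ i → indices i + suc y ≡ entries i
  central⁻ {y} y<m with c , c<m , compl ← complement y<m
    with i , eq ← fiber {suc (m + m)} 2 {c} (ℕ.<-≤-trans c<m (ℕ.m≤n⇒m≤1+n (ℕ.m≤m+n m m))) =
    i , trans (cong (λ s → toℕ i + s + suc y) eq) (trans (ℕ.+-assoc (toℕ i) c (suc y))
      (trans (cong (_+_ (toℕ i)) compl) (trans (ℕ.+-comm (toℕ i) m) (sym (entries-value i)))))

shift-period : ∀ (i : Fin n) → shift n i ≡ i
shift-period {n} i = Fin.toℕ-injective (toℕ-shift-< n i (Fin.toℕ<n i) (ℕ.+-comm (toℕ i) n))

-- With the lag q = m − 1 and x = m, 1, m+1, 2, …, 2m−1, 0 the central entry is (i − q mod n) − m,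
-- except that it is m (instead of 0) in the last row. The diagonals used are 0, 1, 2, m and m + 2.
five-even : ∀ q → let m = suc q in
  Circulant (m + m) 5 0 (m + (m + m + (m + m))) (2 + m ∷ 0 ∷ 1 ∷ 2 ∷ m ∷ [])
five-even q = five (λ ()) (λ y< → central⁺ (ℕ.m<1+n⇒m<n∨m≡n y<)) central⁻
  opposite (λ _ → refl) (λ _ → refl) (λ _ → refl)
  where
  m l : ℕ
  m = suc q
  l = q + m
  f x : ℕ → ℕ
  f = zig m 1
  x = join l f (λ _ → 0)

  l≡ : q + m ≡ suc (q + q)
  l≡ = ℕ.+-suc q q

  x-last : x l ≡ 0
  x-last = trans (cong x (sym (ℕ.+-identityʳ l))) (join-≥ l f (λ _ → 0) 0)

  takes : ∀ {y} → y < m + m → Takes x (m + m) y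
  takes {zero} _ = takes-at x (ℕ.n<1+n l) x-last
  takes {suc y} (s≤s y<l) with split-< q y<l
  ... | inj₁ y<q = takes-at x (ℕ.m<n⇒m<1+n y-bound) (trans (join-< l f (λ _ → 0) y-bound) (zig-odd m 1 y))
    where
    y-bound : suc (y + y) < l
    y-bound = ℕ.<-≤-trans (suc-double-< y<q) (ℕ.+-monoʳ-≤ q (ℕ.n≤1+n q))
  ... | inj₂ (w , s≤s w≤q , refl) = takes-at x (ℕ.m<n⇒m<1+n w-bound)
      (trans (join-< l f (λ _ → 0) w-bound) (zig-even m 1 w))
    where
    w-bound : w + w < l
    w-bound = subst (w + w <_) (sym l≡) (s<s (ℕ.+-mono-≤ w≤q w≤q))

  open Five 0 m q x takes

  entries-value : ∀ i → toℕ i ≢ l → entries i ≡ m + toℕ i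
  entries-value zero 0≢l = trans (cong₂ _+_ (join-< l f (λ _ → 0) (ℕ.n≢0⇒n>0 (0≢l ∘ sym)))
    (trans (cong x (Fin.toℕ-fromℕ l)) x-last)) refl
  entries-value (suc i) i≢l = trans (cong₂ _+_ (join-< l f (λ _ → 0) i<l)
      (trans (cong x (toℕ-σ-suc i)) (join-< l f (λ _ → 0) (ℕ.<-trans (ℕ.n<1+n _) i<l))))
    (trans (zig-adjacent m 1 (toℕ i)) (ℕ.+-assoc m 1 (toℕ i)))
    where
    i<l : suc (toℕ i) < l
    i<l = ℕ.≤∧≢⇒< (ℕ.s≤s⁻¹ (Fin.toℕ<n (suc i))) i≢l

  i₀ : Fin (m + m)
  i₀ = Fin.fromℕ l

  -- The shifted index m marks the exceptional last row. The rows chosen for the other central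
  -- entries have a different shifted index, so `entries-value` applies to them.
  shifted-last : ∀ {i} → toℕ i ≡ l → toℕ (shift q i) ≡ m
  shifted-last {i} eq = toℕ-shift-≥ q i eq

  central⁺ : ∀ {y} → y < q ⊎ y ≡ q → ∃ λ i → indices i ≡ entries i + suc y
  central⁺ {y} (inj₁ y<q) with i , eq ← fiber {m + m} q {suc (m + y)}
      (s<s (ℕ.<-≤-trans (ℕ.+-monoʳ-< m y<q) (ℕ.≤-reflexive (ℕ.+-comm m q)))) =
    i , trans (cong (_+_ (toℕ i)) eq) (trans (regroup (toℕ i) m y)
      (cong (_+ suc y) (sym (entries-value i λ last → ℕ.m≢1+m+n m (trans (sym (shifted-last last)) eq)))))
    where
    regroup : ∀ i m y → i + suc (m + y) ≡ m + i + suc y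
    regroup = ℕ.solve-∀
  central⁺ (inj₂ refl) = i₀ , cong₂ _+_
    (trans (Fin.toℕ-fromℕ l) (sym last-entries)) (shifted-last (Fin.toℕ-fromℕ l))
    where
    last-entries : entries i₀ ≡ l
    last-entries = last (Fin.toℕ-fromℕ l)
      where
      last : ∀ {i} → toℕ i ≡ l → entries i ≡ l
      last {zero} eq with () ← trans eq l≡
      last {suc i} eq = trans (cong₂ _+_ (trans (cong x eq) x-last)
        (trans (cong x (trans (toℕ-σ-suc i) (ℕ.suc-injective (trans eq l≡))))
          (trans (join-< l f (λ _ → 0) (ℕ.+-monoʳ-< q (ℕ.n<1+n q))) (zig-even m 1 q))))
        (ℕ.+-comm m q)

  central⁻ : ∀ {y} → y < m → ∃ λ i → indices i + suc y ≡ entries i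
  central⁻ {y} y<m with c , c<m , compl ← complement y<m
    with i , eq ← fiber {m + m} q {c} (ℕ.<-≤-trans c<m (ℕ.m≤m+n m m)) =
    i , trans (cong (λ s → toℕ i + s + suc y) eq) (trans (ℕ.+-assoc (toℕ i) c (suc y))
      (trans (cong (_+_ (toℕ i)) compl) (trans (ℕ.+-comm (toℕ i) m)
        (sym (entries-value i λ last → ℕ.<-irrefl (trans (sym eq) (shifted-last last)) c<m)))))

  opposite : ∀ (j : Fin (m + m)) → shift q (shift (2 + m) j) ≡ σ j
  -- q + (2 + m) = n + 1: a full turn and one more step.
  opposite j = trans (sym (shift-+ (2 + m) q j))
    (trans (cong (λ k → shift (suc k) j) (cong suc (ℕ.+-comm m q))) (shift-period (σ j)))

-- Six diagonals, n even

zig-suc : ∀ x y i → zig (suc x) (suc y) i ≡ suc (zig x y i)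
zig-suc x y zero = refl
zig-suc x y (suc i) = zig-suc y (suc x) i

off₆-gap : Vector ℕ 6
off₆-gap = 0 ∷ 1 ∷ 2 ∷ 4 ∷ 5 ∷ 6 ∷ []

-- Row i contains p i, q i, s i, the negatives of which are four rows further down; p + q + s
-- depends only on the parity of i. The shift has to be even, so diagonal 3 stays empty.
module EvenSix (m′ : ℕ) where
  m n₁ : ℕ
  m = suc m′
  n₁ = m + m
  z : ℕ → ℕ
  z = zig 0 m

  p q s : Fin n₁ → ℤ
  p i = + suc (toℕ i)
  q i = + n₁ ℤ.+ + n₁ ℤ.- + z (toℕ i)
  s i = -[1+ n₁ + (n₁ + z (toℕ i)) ]

  val : Fin n₁ → Vector ℤ 6
  val i = let τi = shift 4 i in ℤ.- p τi ∷ ℤ.- q τi ∷ ℤ.- s τi ∷ p i ∷ q i ∷ s i ∷ []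

  -- The row total p + q + s is i - 2 z(i), here compared without subtraction: two steps change i by
  -- 2 and z by 1. It is 0 in even rows and 1 - n in odd rows, and since n is even the wrap-around
  -- keeps the parity.
  two-step : ∀ i → toℕ (shift 2 i) + (z (toℕ i) + z (toℕ i)) ≡ toℕ i + (z (toℕ (shift 2 i)) + z (toℕ (shift 2 i)))
  two-step i with toℕ i in eq
  ... | zero rewrite toℕ-shift-< 2 i {m′ + m′} (subst (_< 2) (sym eq) z<s)
                      (trans (cong (_+ n₁) eq) (cong suc (ℕ.+-suc m′ m′)))
                    | zig-even 0 m m′ = ℕ.+-identityʳ (m′ + m′)
  ... | suc zero rewrite toℕ-shift-< 2 i {suc (m′ + m′)} (subst (_< 2) (sym eq) (s<s z<s))
                           (trans (cong (_+ n₁) eq) (cong (λ k → suc (suc k)) (ℕ.+-suc m′ m′)))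
                         | zig-odd 0 m m′ = regroup m′
    where
    regroup : ∀ m → suc (m + m) + (suc m + suc m) ≡ 1 + (suc m + m + (suc m + m))
    regroup = ℕ.solve-∀
  ... | suc (suc k) rewrite toℕ-shift-≥ 2 i eq | zig-suc 0 m k = regroup k (z k)
    where
    regroup : ∀ k z → k + (suc z + suc z) ≡ suc (suc k) + (z + z)
    regroup = ℕ.solve-∀

  total : Fin n₁ → ℤ
  total i = p i ℤ.+ (q i ℤ.+ s i)

  total-two-step : ∀ i → total (shift 2 i) ≡ total i
  total-two-step i = ℤ-balance (cong +_ (two-step i))
    (ring (+ n₁) (+ toℕ i) (+ z (toℕ i)) (+ toℕ (shift 2 i)) (+ z (toℕ (shift 2 i))))
    where
    ring : ∀ n i z i′ z′ →
      1ℤ ℤ.+ i′ ℤ.+ (n ℤ.+ n ℤ.- z′ ℤ.+ ℤ.- (1ℤ ℤ.+ (n ℤ.+ (n ℤ.+ z′)))) ℤ.+ (i ℤ.+ (z′ ℤ.+ z′))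
      ≡ 1ℤ ℤ.+ i ℤ.+ (n ℤ.+ n ℤ.- z ℤ.+ ℤ.- (1ℤ ℤ.+ (n ℤ.+ (n ℤ.+ z)))) ℤ.+ (i′ ℤ.+ (z ℤ.+ z))
    ring = ℤ.solve-∀

  takes : ∀ {y} → y < n₁ → Takes z n₁ y
  takes y< with split-< m y<
  ... | inj₁ y<m = takes-at z (double-< y<m) (zig-even 0 m _)
  ... | inj₂ (w , w<m , refl) = takes-at z (suc-double-< w<m) (zig-odd 0 m w)

  q-value : ∀ i {w} → z (toℕ i) + suc w ≡ n₁ → q i ≡ + suc (n₁ + w)
  q-value i {w} eq = ℤ-balance (cong +_ (sym eq)) (ring (+ n₁) (+ w) (+ z (toℕ i)))
    where
    ring : ∀ n w z → n ℤ.+ n ℤ.- z ℤ.+ (z ℤ.+ (1ℤ ℤ.+ w)) ≡ 1ℤ ℤ.+ (n ℤ.+ w) ℤ.+ n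
    ring = ℤ.solve-∀

  plus : ∀ {y} → y < n₁ ⊎ (∃ λ w → w < n₁ + n₁ × y ≡ n₁ + w) → Occurs val (+ suc y)
  plus (inj₁ y<n) = fromℕ< y<n , 3F , cong (+_ ∘ suc) (Fin.toℕ-fromℕ< y<n)
  plus (inj₂ (w , w< , refl)) with split-< n₁ w<
  ... | inj₁ w<n with c , c< , compl ← complement w<n with i , eq ← takes c< =
    i , 4F , q-value i (trans (cong (_+ suc w) eq) compl)
  ... | inj₂ (v , v<n , refl) with i , eq ← takes-shifted 4 z (takes v<n) =
    i , 2F , cong (λ k → + suc (n₁ + (n₁ + k))) eq

  minus : ∀ {y} → y < n₁ ⊎ (∃ λ w → w < n₁ + n₁ × y ≡ n₁ + w) → Occurs val -[1+ y ]
  minus (inj₁ y<n) with i , eq ← fiber 4 y<n = i , 0F , cong -[1+_] eq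
  minus (inj₂ (w , w< , refl)) with split-< n₁ w<
  ... | inj₁ w<n with c , c< , compl ← complement w<n with i , eq ← takes-shifted 4 z (takes c<) =
    i , 1F , cong ℤ.-_ (q-value (shift 4 i) (trans (cong (_+ suc w) eq) compl))
  ... | inj₂ (v , v<n , refl) with i , eq ← takes v<n =
    i , 5F , cong (λ k → -[1+ n₁ + (n₁ + k) ]) eq

  six-even : Circulant n₁ 6 0 (n₁ + (n₁ + n₁)) off₆-gap
  six-even = record
    { val = val
    ; size = size n₁
    ; row-zero = λ i → trans (row-+ (p i) (q i) (s i) (p (shift 4 i)) (q (shift 4 i)) (s (shift 4 i)))
        (ℤ.i≡j⇒i-j≡0 (sym (trans (total-two-step (shift 2 i)) (total-two-step i))))
    ; col-zero = λ j → col-+ (p (shift 4 j)) (q (shift 5 j)) (s (shift 6 j))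
    ; occurs⁰ = λ ()
    ; occurs⁺ = λ y< → plus (split-< n₁ y<)
    ; occurs⁻ = λ y< → minus (split-< n₁ y<)
    }
    where
    size : ∀ n → n * 6 ≡ n + (n + n) + (n + (n + n))
    size = ℕ.solve-∀
    row-+ : ∀ p q s p′ q′ s′ → ℤ.- p′ ℤ.+ (ℤ.- q′ ℤ.+ (ℤ.- s′ ℤ.+ (p ℤ.+ (q ℤ.+ (s ℤ.+ 0ℤ)))))
      ≡ p ℤ.+ (q ℤ.+ s) ℤ.- (p′ ℤ.+ (q′ ℤ.+ s′))
    row-+ = ℤ.solve-∀
    col-+ : ∀ p q s → ℤ.- p ℤ.+ (ℤ.- q ℤ.+ (ℤ.- s ℤ.+ (p ℤ.+ (q ℤ.+ (s ℤ.+ 0ℤ))))) ≡ 0ℤ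
    col-+ = ℤ.solve-∀

odd? : ℕ → Bool
odd? zero = false
odd? (suc zero) = true
odd? (suc (suc i)) = odd? i

-- The j-th row of the cycle with the given parity.
bit+double : Bool → ℕ → ℕ
bit+double false j = j + j
bit+double true j = suc (j + j)

odd?-bit+double : ∀ c j → odd? (bit+double c j) ≡ c
odd?-bit+double false zero = refl
odd?-bit+double true zero = refl
odd?-bit+double false (suc j) = trans (cong (λ k → odd? (suc k)) (ℕ.+-suc j j)) (odd?-bit+double false j)
odd?-bit+double true (suc j) = trans (cong (λ k → odd? (suc (suc k))) (ℕ.+-suc j j)) (odd?-bit+double true j)

half-bit+double : ∀ c j → ⌊ bit+double c j /2⌋ ≡ j
half-bit+double false zero = refl
half-bit+double true zero = refl
half-bit+double false (suc j) =
  trans (cong (λ k → ⌊ suc k /2⌋) (ℕ.+-suc j j)) (cong suc (half-bit+double false j))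
half-bit+double true (suc j) =
  trans (cong (λ k → ⌊ suc (suc k) /2⌋) (ℕ.+-suc j j)) (cong suc (half-bit+double true j))

bit+double-< : ∀ c {j k} → j < k → bit+double c j < k + k
bit+double-< false = double-<
bit+double-< true = suc-double-<

off₆-interleaved : Vector ℕ 6
off₆-interleaved = 0 ∷ 2 ∷ 4 ∷ 1 ∷ 3 ∷ 5 ∷ []

-- For n = 2h with h odd, steps of length 2 split the rows into two cycles of odd length h, on
-- which a plain zigzag works. Number the intervals kh+1 … kh+h (k < 6) by k: the two cycles of
-- layer A fill +0, +4, −0 and +1, +5, −2, those of −B fill −1, −5, +2 and −3, −4, +3.
module TwoCycles (p : ℕ) where
  h n₁ : ℕ
  h = suc (p + p)
  n₁ = h + h

  class : Fin n₁ → Bool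
  class i = odd? (toℕ i)
  z : Fin n₁ → ℕ
  z i = zig 0 (suc p) ⌊ toℕ i /2⌋
  r : ℤ
  r = 1ℤ ℤ.+ (+ h ℤ.+ + h ℤ.+ (+ h ℤ.+ + h) ℤ.+ + p)

  at-even : h + suc (p + p) ≡ suc (suc ((p + p) + (p + p)))
  at-even = cong suc (ℕ.+-suc (p + p) (p + p))

  class-two-step : ∀ i → class (shift 2 i) ≡ class i
  class-two-step i with toℕ i in eq
  ... | zero = trans (cong odd? (toℕ-shift-< 2 i {bit+double false (p + p)} (subst (_< 2) (sym eq) z<s)
                 (trans (cong (_+ n₁) eq) at-even)))
               (odd?-bit+double false (p + p))
  ... | suc zero = trans (cong odd? (toℕ-shift-< 2 i {bit+double true (p + p)} (subst (_< 2) (sym eq) (s<s z<s))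
                     (trans (cong (_+ n₁) eq) (cong suc at-even))))
                   (odd?-bit+double true (p + p))
  ... | suc (suc k) = cong odd? (toℕ-shift-≥ 2 i eq)

  -- This is `zig-cyclic` along each cycle: rows 0 and 1 wrap to the last row of their own parity,
  -- where the zigzag of odd length h = 2p + 1 ends on p.
  z-adjacent : ∀ i → z i + z (shift 2 i) ≡ p + ⌊ toℕ i /2⌋
  z-adjacent i with toℕ i in eq
  ... | zero rewrite toℕ-shift-< 2 i {bit+double false (p + p)} (subst (_< 2) (sym eq) z<s)
                       (trans (cong (_+ n₁) eq) at-even)
                   | half-bit+double false (p + p) | zig-even 0 (suc p) p = sym (ℕ.+-identityʳ p)
  ... | suc zero rewrite toℕ-shift-< 2 i {bit+double true (p + p)} (subst (_< 2) (sym eq) (s<s z<s))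
                           (trans (cong (_+ n₁) eq) (cong suc at-even))
                       | half-bit+double true (p + p) | zig-even 0 (suc p) p = sym (ℕ.+-identityʳ p)
  ... | suc (suc k) rewrite toℕ-shift-≥ 2 i eq =
    trans (zig-adjacent 0 (suc p) ⌊ k /2⌋) (sym (ℕ.+-suc p ⌊ k /2⌋))

  -- On each cycle, a, c and -b fill the h numbers following `β`, `β + K` and `γ`. The sum `r` is to
  -- be the same for both cycles and both layers, so that one layer cancels the other; this forces
  -- 2β + K - γ = 4h, which is `balance`.
  module Layer (β K γ : Bool → ℕ) (balance : ∀ c → β c + β c + K c ≡ h + h + (h + h) + γ c) where
    a b c : Fin n₁ → ℤ
    a i = + suc (β (class i) + z i)
    c i = a (shift 2 i) ℤ.+ + K (class i)
    b i = r ℤ.- (a i ℤ.+ c i)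

    b-value : ∀ i → b i ≡ -[1+ γ (class i) + ⌊ toℕ i /2⌋ ]
    b-value i rewrite class-two-step i = ℤ-balance
      (cong₂ (λ x y → + (x + y)) (sym (z-adjacent i)) (sym (balance (class i))))
      (ring (+ h) (+ p) (+ β (class i)) (+ K (class i)) (+ γ (class i)) (+ ⌊ toℕ i /2⌋) (+ z i) (+ z (shift 2 i)))
      where
      ring : ∀ h p β K γ j z z′ →
        1ℤ ℤ.+ (h ℤ.+ h ℤ.+ (h ℤ.+ h) ℤ.+ p) ℤ.- (1ℤ ℤ.+ (β ℤ.+ z) ℤ.+ (1ℤ ℤ.+ (β ℤ.+ z′) ℤ.+ K))
          ℤ.+ (z ℤ.+ z′ ℤ.+ (β ℤ.+ β ℤ.+ K))
        ≡ ℤ.- (1ℤ ℤ.+ (γ ℤ.+ j)) ℤ.+ (p ℤ.+ j ℤ.+ (h ℤ.+ h ℤ.+ (h ℤ.+ h) ℤ.+ γ))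
      ring = ℤ.solve-∀

    place : ∀ e {j} → j < h → ∃ λ i → class i ≡ e × ⌊ toℕ i /2⌋ ≡ j
    place e {j} j<h = fromℕ< bound
      , trans (cong odd? (Fin.toℕ-fromℕ< bound)) (odd?-bit+double e j)
      , trans (cong ⌊_/2⌋ (Fin.toℕ-fromℕ< bound)) (half-bit+double e j)
      where
      bound : bit+double e j < n₁
      bound = bit+double-< e j<h

    place-z : ∀ e {y} → y < h → ∃ λ i → class i ≡ e × z i ≡ y
    place-z e y<h with j , eq ← zig-takes p y<h with i , ci , hi ← place e (Fin.toℕ<n j) =
      i , ci , trans (cong (zig 0 (suc p)) hi) eq

    a-takes : ∀ e {y v} → y < h → β e + y ≡ v → ∃ λ i → a i ≡ + suc v
    a-takes e y<h refl with i , refl , refl ← place-z e y<h = i , refl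

    b-takes : ∀ e {y v} → y < h → γ e + y ≡ v → ∃ λ i → b i ≡ -[1+ v ]
    b-takes e y<h refl with i , refl , refl ← place e y<h = i , b-value i

    c-takes : ∀ e {y v} → y < h → β e + y + K e ≡ v → ∃ λ i → c i ≡ + suc v
    c-takes e y<h refl with i , refl , refl ← place-z e y<h with j , refl ← unshift 2 i =
      j , cong (λ k → + suc (β (class (shift 2 j)) + z (shift 2 j) + K k)) (sym (class-two-step j))

    row-r : ∀ i → c i ℤ.+ (b i ℤ.+ a i) ≡ r
    row-r i = ring (a i) (c i) r
      where
      ring : ∀ a c r → c ℤ.+ (r ℤ.- (a ℤ.+ c) ℤ.+ a) ≡ r
      ring = ℤ.solve-∀

    col-r : ∀ j → c j ℤ.+ (b (shift 2 j) ℤ.+ a (shift 4 j)) ≡ r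
    col-r j = trans
      (cong (λ e → c j ℤ.+ (r ℤ.- (a (shift 2 j) ℤ.+ (a (shift 4 j) ℤ.+ + K e)) ℤ.+ a (shift 4 j)))
        (class-two-step j))
      (ring (a (shift 2 j)) (a (shift 4 j)) (+ K (class j)) r)
      where
      ring : ∀ a a′ k r → a ℤ.+ k ℤ.+ (r ℤ.- (a ℤ.+ (a′ ℤ.+ k)) ℤ.+ a′) ≡ r
      ring = ℤ.solve-∀

  β₁ K₁ γ₁ β₂ K₂ γ₂ : Bool → ℕ
  β₁ false = 0
  β₁ true = h
  K₁ _ = h + h + (h + h)
  γ₁ false = 0
  γ₁ true = h + h
  β₂ false = h
  β₂ true = h + (h + h)
  K₂ false = h + h + (h + h)
  K₂ true = h
  γ₂ false = h + h
  γ₂ true = h + (h + h)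

  balance₁ : ∀ c → β₁ c + β₁ c + K₁ c ≡ h + h + (h + h) + γ₁ c
  balance₁ false = sym (ℕ.+-identityʳ _)
  balance₁ true = ℕ.+-comm (h + h) _

  balance₂ : ∀ c → β₂ c + β₂ c + K₂ c ≡ h + h + (h + h) + γ₂ c
  balance₂ false = ℕ.+-comm (h + h) _
  balance₂ true = ring h
    where
    ring : ∀ h → h + (h + h) + (h + (h + h)) + h ≡ h + h + (h + h) + (h + (h + h))
    ring = ℕ.solve-∀

  module A = Layer β₁ K₁ γ₁ balance₁
  module B = Layer β₂ K₂ γ₂ balance₂

  val : Fin n₁ → Vector ℤ 6
  val i = A.c i ∷ A.b i ∷ A.a i ∷ ℤ.- B.c i ∷ ℤ.- B.b i ∷ ℤ.- B.a i ∷ []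

  via : ∀ {v} d → (∃ λ i → val i d ≡ v) → Occurs val v
  via d (i , eq) = i , d , eq

  negated : ∀ {f : Fin n₁ → ℤ} {v} → (∃ λ i → f i ≡ v) → ∃ λ i → ℤ.- f i ≡ ℤ.- v
  negated (i , eq) = i , cong ℤ.-_ eq

  both : ∀ {y} → y < h + (h + (h + (h + (h + h)))) → Occurs val (+ suc y) × Occurs val -[1+ y ]
  both y< with split-< h y<
  ... | inj₁ y<h = via 2F (A.a-takes false y<h refl) , via 1F (A.b-takes false y<h refl)
  ... | inj₂ (w , w< , refl) with split-< h w<
  ... | inj₁ w<h = via 2F (A.a-takes true w<h refl) , via 5F (negated (B.a-takes false w<h refl))
  ... | inj₂ (w , w< , refl) with split-< h w<
  ... | inj₁ w<h = via 4F (negated (B.b-takes false w<h (ℕ.+-assoc h h w)))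
                 , via 1F (A.b-takes true w<h (ℕ.+-assoc h h w))
  ... | inj₂ (w , w< , refl) with split-< h w<
  ... | inj₁ w<h = via 4F (negated (B.b-takes true w<h (ring h w)))
                 , via 5F (negated (B.a-takes true w<h (ring h w)))
    where
    ring : ∀ h w → h + (h + h) + w ≡ h + (h + (h + w))
    ring = ℕ.solve-∀
  ... | inj₂ (w , w< , refl) with split-< h w<
  ... | inj₁ w<h = via 0F (A.c-takes false w<h (ring₁ h w)) , via 3F (negated (B.c-takes true w<h (ring₂ h w)))
    where
    ring₁ : ∀ h w → w + (h + h + (h + h)) ≡ h + (h + (h + (h + w)))
    ring₁ = ℕ.solve-∀
    ring₂ : ∀ h w → h + (h + h) + w + h ≡ h + (h + (h + (h + w)))
    ring₂ = ℕ.solve-∀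
  ... | inj₂ (w , w<h , refl) = via 0F (A.c-takes true w<h (ring h w))
                                   , via 3F (negated (B.c-takes false w<h (ring h w)))
    where
    ring : ∀ h w → h + w + (h + h + (h + h)) ≡ h + (h + (h + (h + (h + w))))
    ring = ℕ.solve-∀

  six-4k+2 : Circulant n₁ 6 0 (h + (h + (h + (h + (h + h))))) off₆-interleaved
  six-4k+2 = record
    { val = val
    ; size = size h
    ; row-zero = λ i → trans (split (A.c i) (A.b i) (A.a i) (B.c i) (B.b i) (B.a i))
        (ℤ.i≡j⇒i-j≡0 (trans (A.row-r i) (sym (B.row-r i))))
    ; col-zero = λ j → trans (split (A.c j) (A.b (shift 2 j)) (A.a (shift 4 j))
          (B.c (shift 1 j)) (B.b (shift 3 j)) (B.a (shift 5 j)))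
        (ℤ.i≡j⇒i-j≡0 (trans (A.col-r j) (sym (B.col-r (shift 1 j)))))
    ; occurs⁰ = λ ()
    ; occurs⁺ = λ y< → proj₁ (both y<)
    ; occurs⁻ = λ y< → proj₂ (both y<)
    }
    where
    size : ∀ h → (h + h) * 6 ≡ h + (h + (h + (h + (h + h)))) + (h + (h + (h + (h + (h + h)))))
    size = ℕ.solve-∀
    split : ∀ p q s p′ q′ s′ → p ℤ.+ (q ℤ.+ (s ℤ.+ (ℤ.- p′ ℤ.+ (ℤ.- q′ ℤ.+ (ℤ.- s′ ℤ.+ 0ℤ)))))
      ≡ p ℤ.+ (q ℤ.+ s) ℤ.- (p′ ℤ.+ (q′ ℤ.+ s′))
    split = ℤ.solve-∀

-- Stacking blocks on the base systems

SMS : ℕ → ℕ → Set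
SMS n t = ∃ λ (A : PartialArray n) → IsSMS n t A

∷-injective : ∀ {a} {off : Vector ℕ t} → (∀ d → a ≢ off d) → Injective _≡_ _≡_ off → Injective _≡_ _≡_ (a ∷ off)
∷-injective a∉ inj {zero} {zero} _ = refl
∷-injective a∉ inj {zero} {suc e} eq = ⊥-elim (a∉ e eq)
∷-injective a∉ inj {suc d} {zero} eq = ⊥-elim (a∉ d (sym eq))
∷-injective a∉ inj {suc d} {suc e} eq = cong suc (inj eq)

-- A decision procedure, as is `distinct?`, so that concrete offsets are checked by evaluation
-- through `from-yes`.
bounded? : ∀ b (off : Vector ℕ t) → _
bounded? b off = Fin.all? λ d → off d ℕ.<? b

distinct? : (off : Vector ℕ t) → _
distinct? off = Fin.all? λ d → Fin.all? λ e → (off d ℕ.≟ off e) →-dec (d Fin.≟ e)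

-- With s = 2 and w = 4 each block occupies diagonals 0 ... 3 and lifts all others by 4, so a base
-- system lying within the first `b` diagonals grows into one within the first 4Q + b.
consecutive : ∀ {n t ε N b} {off : Vector ℕ t} → Circulant n t ε N off → ε ≤ 1 → (∀ d → off d < b) →
  (∀ d e → off d ≡ off e → d ≡ e) → ∀ Q → Q * 4 + b ≤ n → SMS n (Q * 4 + t)
consecutive {n = n} {t = t} {ε = ε} {b = b} C ε≤1 off< off-inj Q fits =
  let off′ , _ , C′ , off′< , off′-inj = grow Q
  in _ , ToSMS.isSMS C′ ε≤1 (λ d → ℕ.<-≤-trans (off′< d) fits) off′-inj
  where
  grow : ∀ Q → ∃₂ λ (off′ : Vector ℕ (Q * 4 + t)) N′ → Circulant n (Q * 4 + t) ε N′ off′ ×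
    (∀ d → off′ d < Q * 4 + b) × Injective _≡_ _≡_ off′
  grow zero = _ , _ , C , off< , off-inj _ _
  grow (suc Q) with off′ , _ , C′ , off′< , off′-inj ← grow Q =
    _ , _ , extend 2 4 C′
    , (λ where
        0F → z<s
        1F → s<s z<s
        2F → s<s (s<s z<s)
        3F → s<s (s<s (s<s z<s))
        (suc (suc (suc (suc d)))) → ℕ.+-monoʳ-< 4 (off′< d))
    , ∷-injective (λ { 0F () ; 1F () ; 2F () ; (suc (suc (suc _))) () })
      (∷-injective (λ { 0F () ; 1F () ; (suc (suc _)) () })
      (∷-injective (λ { 0F () ; (suc _) () })
      (∷-injective (λ _ ()) λ eq → off′-inj (ℕ.+-cancelˡ-≡ 4 _ _ eq))))

double-cancel-≤ : ∀ {a b} → a + a ≤ b + b → a ≤ b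
double-cancel-≤ {a} {b} 2a≤2b with ℕ.≤-<-connex a b
... | inj₁ a≤b = a≤b
... | inj₂ b<a = ⊥-elim (ℕ.<-irrefl refl (ℕ.<-≤-trans (ℕ.+-mono-< b<a b<a) 2a≤2b))

suc-double-cancel-≤ : ∀ {a b} → suc (a + a) ≤ b + b → a < b
suc-double-cancel-≤ {a} {b} 2a<2b with ℕ.<-≤-connex a b
... | inj₁ a<b = a<b
... | inj₂ b≤a = ⊥-elim (ℕ.<-irrefl refl (ℕ.<-≤-trans 2a<2b (ℕ.+-mono-≤ b≤a b≤a)))

-- Blocks are added in pairs of adjacent diagonals at distance m, so that after Q steps the
-- diagonals lie in two windows of width 2Q + 3 starting at 0 and m.
opposite-sides : ∀ q Q → let m = suc q in Q * 4 + 5 ≤ m + m → SMS (m + m) (Q * 4 + 5)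
opposite-sides q Q fits =
  let off′ , _ , C′ , sides , off′-inj = grow Q width≤m
  in _ , ToSMS.isSMS C′ z≤n (λ d → bounded (sides d)) off′-inj
  where
  m : ℕ
  m = suc q

  width : ℕ → ℕ
  width Q = Q * 2 + 3

  Sided : ℕ → ℕ → Set
  Sided w o = o < w ⊎ (m ≤ o × o < m + w)

  -- The two windows span 4Q + 6 diagonals, one more than are filled. Parity provides it: the odd
  -- number 4Q + 5 is at most 2m, hence so is 4Q + 6.
  width≤m : width Q ≤ m
  width≤m = subst (_≤ m) (regroup₂ Q) (suc-double-cancel-≤ (subst (_≤ m + m) (regroup₁ Q) fits))
    where
    regroup₁ : ∀ Q → Q * 4 + 5 ≡ suc (Q * 2 + 2 + (Q * 2 + 2))
    regroup₁ = ℕ.solve-∀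
    regroup₂ : ∀ Q → suc (Q * 2 + 2) ≡ Q * 2 + 3
    regroup₂ = ℕ.solve-∀

  bounded : ∀ {o} → Sided (width Q) o → o < m + m
  bounded (inj₁ o<w) = ℕ.<-≤-trans o<w (ℕ.≤-trans width≤m (ℕ.m≤m+n m m))
  bounded (inj₂ (_ , o<)) = ℕ.<-≤-trans o< (ℕ.+-monoʳ-≤ m width≤m)

  widen : ∀ {w o} → Sided w o → Sided (2 + w) (2 + o)
  widen (inj₁ o<w) = inj₁ (s<s (s<s o<w))
  widen {w} {o} (inj₂ (m≤o , o<)) = inj₂
    ( ℕ.≤-trans m≤o (ℕ.m≤n+m o 2)
    , subst (2 + o <_) (trans (sym (ℕ.+-suc (suc m) w)) (sym (ℕ.+-suc m (suc w)))) (s<s (s<s o<)))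

  -- The lifted lower window stays below m and the lifted upper one starts at m + 2 or later, which
  -- leaves m and m + 1 vacant for the new pair.
  fresh : ∀ {w o} k → k < 2 → 2 + w ≤ m → Sided w o → m + k ≢ 2 + o
  fresh k _ w≤m (inj₁ o<w) eq =
    ℕ.<-irrefl (sym eq) (ℕ.<-≤-trans (s<s (s<s o<w)) (ℕ.≤-trans w≤m (ℕ.m≤m+n m k)))
  fresh {o = o} k k<2 _ (inj₂ (m≤o , _)) eq = ℕ.<-irrefl eq
    (ℕ.<-≤-trans (ℕ.+-monoʳ-< m k<2) (subst (_≤ 2 + o) (ℕ.+-comm 2 m) (s≤s (s≤s m≤o))))

  grow : ∀ Q → width Q ≤ m → ∃₂ λ (off′ : Vector ℕ (Q * 4 + 5)) N′ →
    Circulant (m + m) (Q * 4 + 5) 0 N′ off′ ×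
    (∀ d → Sided (width Q) (off′ d)) × Injective _≡_ _≡_ off′
  grow zero 3≤m = _ , _ , five-even q
    , (λ where
        0F → inj₂ (ℕ.m≤n+m m 2 , subst (2 + m <_) (ℕ.+-comm 3 m) ℕ.≤-refl)
        1F → inj₁ z<s
        2F → inj₁ (s<s z<s)
        3F → inj₁ (s<s (s<s z<s))
        4F → inj₂ (ℕ.≤-refl , ℕ.m<m+n m z<s))
    , ∷-injective (λ { 0F () ; 1F () ; 2F ()
                     ; 3F eq → ℕ.m≢1+n+m m {1} (sym eq) ; (suc (suc (suc (suc ())))) })
      (∷-injective (λ { 0F () ; 1F () ; 2F () ; (suc (suc (suc ()))) })
      (∷-injective (λ { 0F () ; 1F eq → ℕ.<-irrefl eq (ℕ.<-≤-trans (s<s z<s) 3≤m) ; (suc (suc ())) })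
      (∷-injective (λ { 0F eq → ℕ.<-irrefl eq 3≤m ; (suc ()) })
      (∷-injective (λ ()) λ { {()} }))))
  grow (suc Q) w≤m with off′ , _ , C′ , sides , off′-inj ← grow Q (ℕ.≤-trans (ℕ.m≤n+m (width Q) 2) w≤m) =
    _ , _ , extend m 2 C′
    , (λ where
        0F → inj₁ z<s
        1F → inj₁ (s<s z<s)
        2F → inj₂ (ℕ.≤-refl , ℕ.m<m+n m z<s)
        3F → inj₂ (ℕ.n≤1+n m , subst (_< m + suc (suc (width Q))) (ℕ.+-comm m 1) (ℕ.+-monoʳ-< m (s<s z<s)))
        (suc (suc (suc (suc d)))) → widen (sides d))
    , ∷-injective (λ { 0F () ; 1F () ; 2F () ; (suc (suc (suc _))) () })
      (∷-injective (λ { 0F eq → ℕ.<-irrefl eq (ℕ.<-≤-trans (s<s z<s) w≤m) ; 1F () ; (suc (suc _)) () })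
      (∷-injective (λ where
        0F eq → ℕ.m≢1+n+m m {0} eq
        (suc d) eq → fresh 0 z<s w≤m (sides d) (trans (ℕ.+-identityʳ m) eq))
      (∷-injective (λ d eq → fresh 1 (s<s z<s) w≤m (sides d) (trans (ℕ.+-comm m 1) eq))
      λ eq → off′-inj (ℕ.+-cancelˡ-≡ 2 _ _ eq))))

halves-of : ∀ n → ∃ λ m → n ≡ m + m ⊎ n ≡ suc (m + m)
halves-of n with m , _ , eq ← halve (suc n) {n} (s<s (ℕ.m≤m+n n (suc n))) = m , eq

sms≡3 : ∀ Q → n > 2 → Q * 4 + 3 ≤ n → SMS n (Q * 4 + 3)
sms≡3 {n} Q n>2 fits with halves-of n
... | m , inj₂ refl = consecutive (OddThree.three-odd m) ℕ.≤-refl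
        (from-yes (bounded? 3 off₃)) (from-yes (distinct? off₃)) Q fits
... | m , inj₁ refl with halves-of m
... | suc k , inj₁ refl = consecutive (three-4k k) z≤n
        (from-yes (bounded? 3 off₃)) (from-yes (distinct? off₃)) Q fits
... | suc r , inj₂ refl rewrite ℕ.+-suc r r = consecutive (three-4k+2 r) z≤n
        (from-yes (bounded? 3 off₃)) (from-yes (distinct? off₃)) Q fits
sms≡3 Q () fits | _ , inj₁ refl | zero , inj₁ refl
sms≡3 Q (s≤s (s≤s ())) fits | _ , inj₁ refl | zero , inj₂ refl

sms≡1 : ∀ Q → n > 2 → Q * 4 + 5 ≤ n → SMS n (Q * 4 + 5)
sms≡1 {n} Q n>2 fits with halves-of n
... | m , inj₂ refl = consecutive (five-odd m) ℕ.≤-refl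
        (from-yes (bounded? 5 off₅)) (from-yes (distinct? off₅)) Q fits
... | suc q , inj₁ refl = opposite-sides q Q fits
sms≡1 Q () fits | zero , inj₁ refl

sms≡2 : ∀ Q → n > 2 → Q * 4 + 6 ≤ n → SMS n (Q * 4 + 6)
sms≡2 {n} Q n>2 fits with halves-of n
... | m , inj₂ refl = consecutive (OddSix.six-odd m) z≤n
        (from-yes (bounded? 6 off₆)) (from-yes (distinct? off₆)) Q fits
... | m , inj₁ refl with halves-of m
... | k , inj₂ refl = consecutive (TwoCycles.six-4k+2 k) z≤n
        (from-yes (bounded? 6 off₆-interleaved)) (from-yes (distinct? off₆-interleaved)) Q fits
... | suc k , inj₁ refl = consecutive (EvenSix.six-even (k + suc k)) z≤n
        (from-yes (bounded? 7 off₆-gap)) (from-yes (distinct? off₆-gap)) Q (room (suc k) fits)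
  where
  -- Both 4Q + 8 and 4k are multiples of 4, so 4Q + 6 ≤ 4k already gives 4Q + 8 ≤ 4k: there is room
  -- for the empty diagonal of `off₆-gap`.
  room : ∀ k → Q * 4 + 6 ≤ k + k + (k + k) → Q * 4 + 7 ≤ k + k + (k + k)
  room k le = ℕ.≤-trans (subst (Q * 4 + 7 ≤_) (regroup₃ Q) (ℕ.n≤1+n _)) (ℕ.+-mono-≤ 2Q+4≤2k 2Q+4≤2k)
    where
    regroup₁ : ∀ Q → Q * 4 + 6 ≡ Q * 2 + 3 + (Q * 2 + 3)
    regroup₁ = ℕ.solve-∀
    regroup₂ : ∀ Q → Q * 2 + 3 ≡ suc (Q + 1 + (Q + 1))
    regroup₂ = ℕ.solve-∀
    regroup₃ : ∀ Q → suc (Q * 4 + 7) ≡ suc (Q + 1) + suc (Q + 1) + (suc (Q + 1) + suc (Q + 1))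
    regroup₃ = ℕ.solve-∀
    Q+2≤k : suc (Q + 1) ≤ k
    Q+2≤k = suc-double-cancel-≤ (subst (_≤ k + k) (regroup₂ Q)
      (double-cancel-≤ (subst (_≤ k + k + (k + k)) (regroup₁ Q) le)))
    2Q+4≤2k : suc (Q + 1) + suc (Q + 1) ≤ k + k
    2Q+4≤2k = ℕ.+-mono-≤ Q+2≤k Q+2≤k
sms≡2 Q () fits | _ , inj₁ refl | zero , inj₁ refl

sms≡0 : ∀ Q → Q * 4 + 0 ≤ n → SMS n (Q * 4 + 0)
sms≡0 = consecutive empty z≤n (λ ()) (λ ())

sms-1-1 : SMS 1 1
sms-1-1 = consecutive {b = 1} unit ℕ.≤-refl
  (from-yes (bounded? 1 (0 ∷ []))) (from-yes (distinct? (0 ∷ []))) 0 ℕ.≤-refl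
  where
  unit : Circulant 1 1 1 0 (0 ∷ [])
  unit = record
    { val = λ _ → 0ℤ ∷ []
    ; size = refl
    ; row-zero = λ _ → refl
    ; col-zero = λ _ → refl
    ; occurs⁰ = λ _ → zero , zero , refl
    ; occurs⁺ = λ ()
    ; occurs⁻ = λ ()
    }

existence : n ≥ t → n > 2 → t > 2 → SMS n t
existence {n} {t} n≥t n>2 t>2 = subst (SMS n) (sym decomposition)
  (go (t % 4) (t ℕ./ 4) (ℕ.m%n<n t 4) (subst (_≤ n) decomposition n≥t) (subst (_> 2) decomposition t>2))
  where
  decomposition : t ≡ t ℕ./ 4 * 4 + t % 4
  decomposition = trans (ℕ.m≡m%n+[m/n]*n t 4) (ℕ.+-comm (t % 4) _)

  move : ∀ Q k → 4 + Q * 4 + k ≡ Q * 4 + (4 + k)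
  move = ℕ.solve-∀

  go : ∀ ρ Q → ρ < 4 → Q * 4 + ρ ≤ n → Q * 4 + ρ > 2 → SMS n (Q * 4 + ρ)
  go 0 Q _ fits _ = sms≡0 Q fits
  go 1 zero _ _ (s≤s ())
  -- One block is given back to the base system: 4(Q + 1) + 1 = 4Q + 5, and likewise 4Q + 6 for
  -- residue 2.
  go 1 (suc Q) _ fits _ = subst (SMS n) (sym (move Q 1)) (sms≡1 Q n>2 (subst (_≤ n) (move Q 1) fits))
  go 2 zero _ _ (s≤s (s≤s ()))
  go 2 (suc Q) _ fits _ = subst (SMS n) (sym (move Q 2)) (sms≡2 Q n>2 (subst (_≤ n) (move Q 2) fits))
  go 3 Q _ fits _ = sms≡3 Q n>2 fits
  go (suc (suc (suc (suc _)))) Q (s≤s (s≤s (s≤s (s≤s ())))) _ _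

theorem10 : (n t : ℕ) → n ≥ t → t ≥ 1 →
    (∃ λ (A : PartialArray n) → IsSMS n t A) ⇔ ((n ≡ 1 × t ≡ 1) ⊎ (n > 2 × t > 2))
theorem10 n t n≥t t≥1 = mk⇔ (λ (A , sms) → size-restriction n≥t t≥1 sms) λ where
  (inj₁ (refl , refl)) → sms-1-1
  (inj₂ (n>2 , t>2)) → existence n≥t n>2 t>2
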